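{- Let $T$ be a $\mathbb{Q}$-weighted tile made up of rectangles whose corners all have rational coordinates. Then $T$ $\mathbb{Q}$-shapetiles a square if and only if the weighted area of $T$ is not zero.
   Context: A rectangle is a product $[b_1,b_2)\times[c_1,c_2)\subset\mathbb{R}^2$ of half-open intervals with $b_1<b_2$ and $c_1<c_2$; a square is a rectangle with $b_2-b_1=c_2-c_1$. Let $A$ be a commutative ring with unity. An $A$-weighted tile is represented by a finite $A$-linear combination $a_1R_1+\cdots+a_nR_n$ of disjoint rectangles; to it is associated the function $\mathbb{R}^2\to A$ with value $a_i$ on $R_i$ and $0$ outside $\bigcup R_i$, and two combinations represent the same tile if and only if the associated functions are equal. Tiles are added and multiplied by elements of $A$ pointwise (as functions). An (unweighted) rectangle or square is regarded as a tile with weight $1$. For $A\subset\mathbb{R}$, the weighted area of $a_1R_1+\cdots+a_nR_n$ is $\sum_i a_i\,\mathrm{area}(R_i)$. A set $\{T_\lambda:\lambda\in\Lambda\}$ of $A$-weighted tiles $A$-tiles an $A$-weighted tile $U$ if there are finitely many weights $a_1,\dots,a_n\in A$ and tiles $\tilde T_1,\dots,\tilde T_n$, each a translation (by a vector in $\mathbb{R}^2$) of some $T_{\lambda_i}$, such that $a_1\tilde T_1+\cdots+a_n\tilde T_n=U$ (rotations and reflections are not allowed). For real $\rho>0$, $T(\rho)$ is the image of $T$ under the rescaling $(x,y)\mapsto(\rho x,\rho y)$. The tile $T$ $A$-shapetiles $U$ if $\{T(\rho):\rho\in\mathbb{R},\ \rho>0\}$ $A$-tiles $U$. -}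

module Defs where

open import Algebra.Bundles using (CommutativeRing)
import Algebra.Properties.Monoid.Mult as MonoidMult
open import Data.Bool.Base using (if_then_else_)
open import Data.Integer.Base using (ℤ; +_; -[1+_])
open import Data.List.Base using (List; []; _∷_; [_]; map; foldr)
open import Data.List.Relation.Unary.All as All using (All)
open import Data.List.Relation.Unary.AllPairs as AllPairs using (AllPairs; []; _∷_)
import Data.List.Relation.Unary.AllPairs.Properties as AllPairsₚ
open import Data.Nat.Base using (ℕ)
open import Data.Product.Base using (Σ; ∃; _×_; _,_; proj₁; proj₂; map₂)
open import Data.Rational.Base as ℚ using (ℚ; 0ℚ; 1ℚ; ↥_; ↧_)
open import Data.Sum.Base using (inj₁; inj₂)
open import Level using (Level; _⊔_)
open import Relation.Binary.Core using (Rel)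
open import Relation.Binary.Definitions using (tri<; tri≈; tri>)
open import Relation.Binary.PropositionalEquality using (_≡_)
open import Relation.Binary.Structures using (IsStrictTotalOrder)
import Relation.Binary.Construct.StrictToNonStrict as StrictToNonStrict
open import Relation.Nullary using (¬_; Dec; does; contradiction; _×-dec_; _⊎-dec_)

-- The real numbers, characterised axiomatically as a Dedekind-complete ordered
-- field.  The order is trichotomous, as it is classically: membership in a
-- half-open interval has to be decidable for a weighted tile to be a function
-- on the plane.

record RealNumbers (c ℓ₁ ℓ₂ : Level) : Set (Level.suc (c ⊔ ℓ₁ ⊔ ℓ₂)) where
  infix 4 _<_
  infix 8 _⁻¹
  field
    commutativeRing : CommutativeRing c ℓ₁

  open CommutativeRing commutativeRing public

  field
    _⁻¹                : Carrier → Carrier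
    ⁻¹-cong            : ∀ {x y} → x ≈ y → x ⁻¹ ≈ y ⁻¹
    -- The value of 0# ⁻¹ is left unspecified.
    ⁻¹-inverseʳ        : ∀ {x} → ¬ x ≈ 0# → x * x ⁻¹ ≈ 1#

    _<_                : Rel Carrier ℓ₂
    isStrictTotalOrder : IsStrictTotalOrder _≈_ _<_
    0<1                : 0# < 1#
    +-monoˡ-<          : ∀ z {x y} → x < y → x + z < y + z
    *-pos              : ∀ {x y} → 0# < x → 0# < y → 0# < x * y

  open StrictToNonStrict _≈_ _<_ public using (_≤_)

  UpperBound : ∀ {p} → (Carrier → Set p) → Carrier → Set (c ⊔ ℓ₁ ⊔ ℓ₂ ⊔ p)
  UpperBound P b = ∀ x → P x → x ≤ b

  field
    supremum : (P : Carrier → Set (c ⊔ ℓ₁ ⊔ ℓ₂)) → ∃ P → ∃ (UpperBound P) →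
               ∃ λ s → UpperBound P s × (∀ b → UpperBound P b → s ≤ b)


module RealProperties {c ℓ₁ ℓ₂} (ℝ : RealNumbers c ℓ₁ ℓ₂) where

  open RealNumbers ℝ
  open MonoidMult +-monoid using () renaming (_×_ to _·_)

  module < = IsStrictTotalOrder isStrictTotalOrder

  fromℤ : ℤ → Carrier
  fromℤ (+ n)    = n · 1#
  fromℤ -[1+ n ] = - (ℕ.suc n · 1#)

  fromℚ : ℚ → Carrier
  fromℚ q = fromℤ (↥ q) * fromℤ (↧ q) ⁻¹

  IsRational : Carrier → Set ℓ₁
  IsRational x = ∃ λ q → x ≈ fromℚ q

  infix 4 _≤?_
  _≤?_ : ∀ x y → Dec (x ≤ y)
  x ≤? y = (x <.<? y) ⊎-dec (x <.≟ y)

  <-resp : ∀ {x x′ y y′} → x ≈ x′ → y ≈ y′ → x < y → x′ < y′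
  <-resp x≈x′ y≈y′ x<y = <.<-respˡ-≈ x≈x′ (<.<-respʳ-≈ y≈y′ x<y)

  ≤-resp : ∀ {x x′ y y′} → x ≈ x′ → y ≈ y′ → x ≤ y → x′ ≤ y′
  ≤-resp x≈x′ y≈y′ (inj₁ x<y) = inj₁ (<-resp x≈x′ y≈y′ x<y)
  ≤-resp x≈x′ y≈y′ (inj₂ x≈y) = inj₂ (trans (sym x≈x′) (trans x≈y y≈y′))

  +-monoˡ-≤ : ∀ z {x y} → x ≤ y → x + z ≤ y + z
  +-monoˡ-≤ z (inj₁ x<y) = inj₁ (+-monoˡ-< z x<y)
  +-monoˡ-≤ z (inj₂ x≈y) = inj₂ (+-congʳ x≈y)

  x+z-z≈x : ∀ x z → (x + z) + - z ≈ x
  x+z-z≈x x z = trans (+-assoc x z (- z)) (trans (+-congˡ (-‿inverseʳ z)) (+-identityʳ x))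

  x-z+z≈x : ∀ x z → (x + - z) + z ≈ x
  x-z+z≈x x z = trans (+-assoc x (- z) z) (trans (+-congˡ (-‿inverseˡ z)) (+-identityʳ x))

  *-monoʳ-< : ∀ {ρ x y} → 0# < ρ → x < y → ρ * x < ρ * y
  *-monoʳ-< {ρ} {x} {y} 0<ρ x<y =
    <-resp (+-identityˡ (ρ * x)) ρ[y-x]+ρx≈ρy
      (+-monoˡ-< (ρ * x) (*-pos 0<ρ (<-resp (-‿inverseʳ x) refl (+-monoˡ-< (- x) x<y))))
    where
    ρ[y-x]+ρx≈ρy : ρ * (y + - x) + ρ * x ≈ ρ * y
    ρ[y-x]+ρx≈ρy = trans (sym (distribˡ ρ (y + - x) x)) (*-congˡ (x-z+z≈x y x))

  *-cancelˡ-< : ∀ {ρ x y} → 0# < ρ → ρ * x < ρ * y → x < y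
  *-cancelˡ-< {ρ} {x} {y} 0<ρ ρx<ρy with <.compare x y
  ... | tri< x<y _ _ = x<y
  ... | tri≈ _ x≈y _ = contradiction ρx<ρy (<.irrefl (*-congˡ x≈y))
  ... | tri> _ _ y<x = contradiction ρx<ρy (<.asym (*-monoʳ-< 0<ρ y<x))

  *-cancelˡ-≤ : ∀ {ρ x y} → 0# < ρ → ρ * x ≤ ρ * y → x ≤ y
  *-cancelˡ-≤ 0<ρ (inj₁ ρx<ρy) = inj₁ (*-cancelˡ-< 0<ρ ρx<ρy)
  *-cancelˡ-≤ {ρ} {x} {y} 0<ρ (inj₂ ρx≈ρy) with <.compare x y
  ... | tri< x<y _ _ = inj₁ x<y
  ... | tri≈ _ x≈y _ = inj₂ x≈y
  ... | tri> _ _ y<x = contradiction (*-monoʳ-< 0<ρ y<x) (<.irrefl (sym ρx≈ρy))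

  ρρ⁻¹x≈x : ∀ {ρ} → 0# < ρ → ∀ x → ρ * (ρ ⁻¹ * x) ≈ x
  ρρ⁻¹x≈x {ρ} 0<ρ x =
    trans (sym (*-assoc ρ (ρ ⁻¹) x))
      (trans (*-congʳ (⁻¹-inverseʳ λ ρ≈0 → <.irrefl (sym ρ≈0) 0<ρ)) (*-identityˡ x))


module Tiling {c ℓ₁ ℓ₂} (ℝ : RealNumbers c ℓ₁ ℓ₂) where

  open RealNumbers ℝ public
  open RealProperties ℝ public

  Point : Set c
  Point = Carrier × Carrier

  PositiveReal : Set (c ⊔ ℓ₂)
  PositiveReal = ∃ λ ρ → 0# < ρ

  -- The half-open interval [lo , hi).
  record Interval : Set (c ⊔ ℓ₂) where
    field
      lo hi : Carrier
      lo<hi : lo < hi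

    length : Carrier
    length = hi - lo

  record Rectangle : Set (c ⊔ ℓ₂) where
    field
      horizontal vertical : Interval

    open Interval horizontal public using () renaming (lo to b₁; hi to b₂; length to width)
    open Interval vertical   public using () renaming (lo to c₁; hi to c₂; length to height)

    area : Carrier
    area = width * height

  open Rectangle

  IsSquare : Rectangle → Set ℓ₁
  IsSquare R = width R ≈ height R

  HasRationalCorners : Rectangle → Set ℓ₁
  HasRationalCorners R =
    (IsRational (b₁ R) × IsRational (b₂ R)) × (IsRational (c₁ R) × IsRational (c₂ R))

  infix 4 _∈ᴵ_ _∈ᴿ_ _∈ᴿ?_

  _∈ᴵ_ : Carrier → Interval → Set (ℓ₁ ⊔ ℓ₂)
  x ∈ᴵ I = lo ≤ x × x < hi
    where open Interval I

  _∈ᴿ_ : Point → Rectangle → Set (ℓ₁ ⊔ ℓ₂)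
  (x , y) ∈ᴿ R = x ∈ᴵ horizontal R × y ∈ᴵ vertical R

  _∈ᴿ?_ : ∀ p R → Dec (p ∈ᴿ R)
  (x , y) ∈ᴿ? R = ((b₁ R ≤? x) ×-dec (x <.<? b₂ R)) ×-dec ((c₁ R ≤? y) ×-dec (y <.<? c₂ R))

  Disjoint : Rectangle → Rectangle → Set (c ⊔ ℓ₁ ⊔ ℓ₂)
  Disjoint R S = ∀ p → p ∈ᴿ R → ¬ p ∈ᴿ S

  Piece : Set (c ⊔ ℓ₂)
  Piece = ℚ × Rectangle

  -- A representative of a ℚ-weighted tile; two of them represent the same tile
  -- when their value functions agree at every point.
  record Tile : Set (c ⊔ ℓ₁ ⊔ ℓ₂) where
    field
      pieces   : List Piece
      disjoint : AllPairs (λ P Q → Disjoint (proj₂ P) (proj₂ Q)) pieces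

  open Tile

  valueOf : List Piece → Point → ℚ
  valueOf []             p = 0ℚ
  valueOf ((a , R) ∷ Ps) p = if does (p ∈ᴿ? R) then a else valueOf Ps p

  value : Tile → Point → ℚ
  value T = valueOf (pieces T)

  rectangleTile : Rectangle → Tile
  rectangleTile R = record
    { pieces   = [ (1ℚ , R) ]
    ; disjoint = All.[] ∷ []
    }

  MadeOfRationalRectangles : Tile → Set (c ⊔ ℓ₁ ⊔ ℓ₂)
  MadeOfRationalRectangles T = All (λ P → HasRationalCorners (proj₂ P)) (pieces T)

  weightedArea : Tile → Carrier
  weightedArea T = foldr (λ (a , R) s → fromℚ a * area R + s) 0# (pieces T)

  mapTile : (f : Rectangle → Rectangle) →
            (∀ {R S} → Disjoint R S → Disjoint (f R) (f S)) → Tile → Tile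
  mapTile f f-disjoint T = record
    { pieces   = map (map₂ f) (pieces T)
    ; disjoint = AllPairsₚ.map⁺ (AllPairs.map f-disjoint (disjoint T))
    }

  translateᴵ : Carrier → Interval → Interval
  translateᴵ v I = record
    { lo    = lo + v
    ; hi    = hi + v
    ; lo<hi = +-monoˡ-< v lo<hi
    }
    where open Interval I

  translateᴿ : Point → Rectangle → Rectangle
  translateᴿ (u , v) R = record
    { horizontal = translateᴵ u (horizontal R)
    ; vertical   = translateᴵ v (vertical R)
    }

  ∈-translateᴵ⁻ : ∀ {v x} I → x ∈ᴵ translateᴵ v I → x - v ∈ᴵ I
  ∈-translateᴵ⁻ {v} I (lo+v≤x , x<hi+v) =
    ≤-resp (x+z-z≈x _ v) refl (+-monoˡ-≤ (- v) lo+v≤x) ,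
    <-resp refl (x+z-z≈x _ v) (+-monoˡ-< (- v) x<hi+v)

  translateᴿ-disjoint : ∀ v {R S} → Disjoint R S → Disjoint (translateᴿ v R) (translateᴿ v S)
  translateᴿ-disjoint (u , v) {R} {S} R∩S=∅ (x , y) (x∈R , y∈R) (x∈S , y∈S) =
    R∩S=∅ (x - u , y - v)
      (∈-translateᴵ⁻ (horizontal R) x∈R , ∈-translateᴵ⁻ (vertical R) y∈R)
      (∈-translateᴵ⁻ (horizontal S) x∈S , ∈-translateᴵ⁻ (vertical S) y∈S)

  translate : Point → Tile → Tile
  translate v = mapTile (translateᴿ v) (λ {R} {S} → translateᴿ-disjoint v {R} {S})

  rescaleᴵ : PositiveReal → Interval → Interval
  rescaleᴵ (ρ , 0<ρ) I = record
    { lo    = ρ * lo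
    ; hi    = ρ * hi
    ; lo<hi = *-monoʳ-< 0<ρ lo<hi
    }
    where open Interval I

  rescaleᴿ : PositiveReal → Rectangle → Rectangle
  rescaleᴿ ρ R = record
    { horizontal = rescaleᴵ ρ (horizontal R)
    ; vertical   = rescaleᴵ ρ (vertical R)
    }

  ∈-rescaleᴵ⁻ : ∀ {x} ρ I → x ∈ᴵ rescaleᴵ ρ I → proj₁ ρ ⁻¹ * x ∈ᴵ I
  ∈-rescaleᴵ⁻ {x} (ρ , 0<ρ) I (ρlo≤x , x<ρhi) =
    *-cancelˡ-≤ 0<ρ (≤-resp refl (sym (ρρ⁻¹x≈x 0<ρ x)) ρlo≤x) ,
    *-cancelˡ-< 0<ρ (<-resp (sym (ρρ⁻¹x≈x 0<ρ x)) refl x<ρhi)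

  rescaleᴿ-disjoint : ∀ ρ {R S} → Disjoint R S → Disjoint (rescaleᴿ ρ R) (rescaleᴿ ρ S)
  rescaleᴿ-disjoint ρ {R} {S} R∩S=∅ (x , y) (x∈R , y∈R) (x∈S , y∈S) =
    R∩S=∅ (proj₁ ρ ⁻¹ * x , proj₁ ρ ⁻¹ * y)
      (∈-rescaleᴵ⁻ ρ (horizontal R) x∈R , ∈-rescaleᴵ⁻ ρ (vertical R) y∈R)
      (∈-rescaleᴵ⁻ ρ (horizontal S) x∈S , ∈-rescaleᴵ⁻ ρ (vertical S) y∈S)

  rescale : PositiveReal → Tile → Tile
  rescale ρ = mapTile (rescaleᴿ ρ) (λ {R} {S} → rescaleᴿ-disjoint ρ {R} {S})

  combination : List (ℚ × Tile) → Point → ℚ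
  combination ts p = foldr (λ (a , T) s → a ℚ.* value T p ℚ.+ s) 0ℚ ts

  -- The finite list consists of triples (aᵢ , λᵢ , vᵢ), standing for the weight aᵢ
  -- on the translate of T λᵢ by vᵢ.
  ℚ-Tiles : ∀ {ℓ} {Λ : Set ℓ} → (Λ → Tile) → Tile → Set (c ⊔ ℓ)
  ℚ-Tiles {Λ = Λ} T U =
    Σ (List (ℚ × Λ × Point)) λ placed →
      ∀ p → combination (map (map₂ λ (i , v) → translate v (T i)) placed) p ≡ value U p

  ℚ-Shapetiles : Tile → Tile → Set (c ⊔ ℓ₂)
  ℚ-Shapetiles T U = ℚ-Tiles (λ ρ → rescale ρ T) U

{-# OPTIONS --safe #-}

-- (⇒) The functions x ↦ [b ≤ x] are linearly independent, so the weighted area depends only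
-- on the function of a tile; a tiling of S then gives area S = ∑ aᵢ ρᵢ² · area T.
--
-- (⇐) Cut T into cells of a common side δ, with weights cⱼ and corners vⱼ, and let Q be a
-- square of side L.  Put s m = ∑ⱼ cⱼ (Q + m vⱼ).  Writing τⱼ for translation by vⱼ, the
-- sequence s satisfies the linear recurrence with characteristic polynomial ∏ⱼ (z - τⱼ), whose
-- constant coefficient is a unit.  Hence s 0 = (∑ⱼ cⱼ) Q, where δ² ∑ⱼ cⱼ = area T, is a
-- combination of translates of finitely many s m with m ≥ 1.  If L is a multiple of m δ, then
-- s m is in turn a sum of translates of the copy of T rescaled by m.

module Submission where

open import Defs
open import Algebra.Bundles using (AbelianGroup; CommutativeMonoid; CommutativeRing)
import Algebra.Construct.DirectProduct as DirectProduct
import Algebra.Properties.AbelianGroup as AbelianGroupₚ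
import Algebra.Properties.CommutativeSemigroup as CommutativeSemigroupₚ
import Algebra.Properties.Group as Groupₚ
import Algebra.Properties.Monoid.Mult as MonoidMult
import Algebra.Properties.Ring as Ringₚ
import Algebra.Properties.Semiring.Mult as SemiringMult
import Algebra.Solver.Ring as RingSolver
open import Algebra.Solver.Ring.AlmostCommutativeRing
  using (fromCommutativeRing; _-Raw-AlmostCommutative⟶_)
open import Data.Bool.Base using (if_then_else_)
open import Data.Integer.Base as ℤ using (ℤ; +_; -[1+_]; _⊖_)
import Data.Integer.Properties as ℤ
open import Data.List.Base as List
  using (List; []; _∷_; _++_; map; concatMap; foldr; downFrom; cartesianProductWith; filter)
open import Data.List.Membership.Propositional.Properties using (∈-map⁺)
import Data.List.Properties as List
open import Data.List.Relation.Unary.All as All using (All; []; _∷_)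
import Data.List.Relation.Unary.All.Properties as Allₚ
open import Data.List.Relation.Unary.AllPairs using (AllPairs; []; _∷_)
open import Data.List.Relation.Unary.Any using (here)
open import Data.Maybe.Base as Maybe using (Maybe)
open import Data.Nat.Base as ℕ using (ℕ; zero; suc; NonZero)
open import Data.Nat.DivMod using (m/n*n≡m)
open import Data.Nat.Divisibility using (_∣_; divides; m∣m*n; n∣m*n; ∣-trans)
open import Data.Nat.ListAction using (product)
open import Data.Nat.ListAction.Properties using (∈⇒∣product; product≢0)
import Data.Nat.Properties as ℕ
open import Data.Product using (Σ; ∃; _×_; _,_; proj₁; proj₂; map₂)
open import Data.Rational.Base as ℚ using (ℚ; 0ℚ; 1ℚ; ↥_; ↧_; mkℚ; toℚᵘ)
import Data.Rational.Properties as ℚ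
import Data.Rational.Solver as ℚ-Solver
import Data.Rational.Unnormalised.Base as ℚᵘ
open import Data.Sum.Base using (inj₁; inj₂)
open import Function.Base using (_∘_; id)
open import Function.Bundles using (_⇔_; mk⇔)
import Level
open import Relation.Binary.Consequences using (dec⇒weaklyDec)
open import Relation.Binary.Definitions using (Tri; tri<; tri≈; tri>)
import Relation.Binary.PropositionalEquality as ≡
open ≡ using (_≡_)
import Relation.Binary.Reasoning.Setoid as ≈-Reasoning
open import Relation.Nullary using (¬_; yes; no; contradiction; does; ¬?)
open import Relation.Nullary.Decidable using (dec-true; dec-false)

-- The term `s 0` cannot be reached directly, since it would call for a copy of T of scale zero. The
-- recurrence is therefore run backwards: its constant coefficient is, up to sign, translation by
-- the sum of the corners `vⱼ`, which is invertible. At index 0 all the squares coincide, so the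
-- weights add up before anything can cancel geometrically, and only their sum has to be nonzero.
-- The combination that recovers `s 0` depends on the corners `vⱼ` alone, neither on the weights nor
-- on L. So L can be chosen afterwards, as a multiple of every scale that occurs, without
-- circularity. For (⇒), the copies in a tiling may overlap and cancel, so areas cannot be compared
-- by covering. Linear independence takes the place of a common refinement: a relation between the
-- functions [b ≤ x] persists when each of them is replaced by the number b, and this substitution
-- is made in one coordinate at a time.

-- Finite sums over lists in a commutative ring.

module ListSum {c ℓ} (R : CommutativeRing c ℓ) where

  open CommutativeRing R
  open MonoidMult +-monoid using () renaming (_×_ to _·_)
  open CommutativeSemigroupₚ (CommutativeMonoid.commutativeSemigroup +-commutativeMonoid)
    using (interchange)
  open Groupₚ +-group using (ε⁻¹≈ε)
  open AbelianGroupₚ +-abelianGroup using (⁻¹-∙-comm)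
  open ≈-Reasoning setoid

  ∑ : ∀ {a} {A : Set a} → List A → (A → Carrier) → Carrier
  ∑ xs f = foldr (λ x s → f x + s) 0# xs

  module _ {a} {A : Set a} where

    ∑-congᴬ : ∀ {f g : A → Carrier} {xs} → All (λ x → f x ≈ g x) xs → ∑ xs f ≈ ∑ xs g
    ∑-congᴬ []          = refl
    ∑-congᴬ (f≈g ∷ all) = +-cong f≈g (∑-congᴬ all)

    ∑-cong : ∀ {f g : A → Carrier} xs → (∀ x → f x ≈ g x) → ∑ xs f ≈ ∑ xs g
    ∑-cong []       f≈g = refl
    ∑-cong (x ∷ xs) f≈g = +-cong (f≈g x) (∑-cong xs f≈g)

    ∑-zero : ∀ xs → ∑ xs (λ (_ : A) → 0#) ≈ 0#
    ∑-zero []       = refl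
    ∑-zero (x ∷ xs) = trans (+-identityˡ _) (∑-zero xs)

    ∑-+ : ∀ xs (f g : A → Carrier) → ∑ xs (λ x → f x + g x) ≈ ∑ xs f + ∑ xs g
    ∑-+ []       f g = sym (+-identityˡ 0#)
    ∑-+ (x ∷ xs) f g = trans (+-congˡ (∑-+ xs f g)) (interchange (f x) (g x) (∑ xs f) (∑ xs g))

    ∑-neg : ∀ xs (f : A → Carrier) → ∑ xs (λ x → - f x) ≈ - ∑ xs f
    ∑-neg []       f = sym ε⁻¹≈ε
    ∑-neg (x ∷ xs) f = trans (+-congˡ (∑-neg xs f)) (⁻¹-∙-comm (f x) (∑ xs f))

    ∑-distribˡ : ∀ y xs (f : A → Carrier) → y * ∑ xs f ≈ ∑ xs (λ x → y * f x)
    ∑-distribˡ y []       f = zeroʳ y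
    ∑-distribˡ y (x ∷ xs) f = trans (distribˡ y (f x) (∑ xs f)) (+-congˡ (∑-distribˡ y xs f))

    ∑-distribʳ : ∀ y xs (f : A → Carrier) → ∑ xs f * y ≈ ∑ xs (λ x → f x * y)
    ∑-distribʳ y xs f =
      trans (*-comm _ y) (trans (∑-distribˡ y xs f) (∑-cong xs λ x → *-comm y (f x)))

    ∑-++ : ∀ xs ys (f : A → Carrier) → ∑ (xs ++ ys) f ≈ ∑ xs f + ∑ ys f
    ∑-++ []       ys f = sym (+-identityˡ _)
    ∑-++ (x ∷ xs) ys f = trans (+-congˡ (∑-++ xs ys f)) (sym (+-assoc _ _ _))

  module _ {a b} {A : Set a} {B : Set b} where

    ∑-map : ∀ (g : A → B) xs (f : B → Carrier) → ∑ (map g xs) f ≈ ∑ xs (f ∘ g)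
    ∑-map g []       f = refl
    ∑-map g (x ∷ xs) f = +-congˡ (∑-map g xs f)

    ∑-concatMap : ∀ (g : A → List B) xs (f : B → Carrier) →
                  ∑ (concatMap g xs) f ≈ ∑ xs (λ x → ∑ (g x) f)
    ∑-concatMap g []       f = refl
    ∑-concatMap g (x ∷ xs) f =
      trans (∑-++ (g x) (concatMap g xs) f) (+-congˡ (∑-concatMap g xs f))

    ∑-swap : ∀ xs ys (f : A → B → Carrier) →
             ∑ xs (λ x → ∑ ys (f x)) ≈ ∑ ys (λ y → ∑ xs (λ x → f x y))
    ∑-swap []       ys f = sym (∑-zero ys)
    ∑-swap (x ∷ xs) ys f =
      trans (+-congˡ (∑-swap xs ys f)) (sym (∑-+ ys (f x) (λ y → ∑ xs (λ x′ → f x′ y))))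

    ∑-∑-* : ∀ c xs ys (f : A → Carrier) (g : B → Carrier) →
            ∑ xs (λ x → ∑ ys (λ y → c * (f x * g y))) ≈ c * (∑ xs f * ∑ ys g)
    ∑-∑-* c xs ys f g = sym (begin
      c * (∑ xs f * ∑ ys g)                           ≈⟨ *-congˡ (∑-distribʳ (∑ ys g) xs f) ⟩
      c * ∑ xs (λ x → f x * ∑ ys g)                   ≈⟨ *-congˡ (∑-cong xs λ x → ∑-distribˡ (f x) ys g) ⟩
      c * ∑ xs (λ x → ∑ ys (λ y → f x * g y))         ≈⟨ ∑-distribˡ c xs _ ⟩
      ∑ xs (λ x → c * ∑ ys (λ y → f x * g y))         ≈⟨ ∑-cong xs (λ x → ∑-distribˡ c ys _) ⟩
      ∑ xs (λ x → ∑ ys (λ y → c * (f x * g y)))       ∎)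

  ∑-cartesianProductWith : ∀ {a b d} {A : Set a} {B : Set b} {D : Set d}
    (g : A → B → D) xs ys (f : D → Carrier) →
    ∑ (cartesianProductWith g xs ys) f ≈ ∑ xs (λ x → ∑ ys (λ y → f (g x y)))
  ∑-cartesianProductWith g []       ys f = refl
  ∑-cartesianProductWith g (x ∷ xs) ys f =
    trans (∑-++ (map (g x) ys) _ f) (+-cong (∑-map (g x) ys f) (∑-cartesianProductWith g xs ys f))

  ∑-const : ∀ n x → ∑ (downFrom n) (λ _ → x) ≈ n · x
  ∑-const zero    x = refl
  ∑-const (suc n) x = +-congˡ (∑-const n x)

  ∑-telescope : ∀ n (h : ℕ → Carrier) → ∑ (downFrom n) (λ i → h i - h (suc i)) ≈ h 0 - h n
  ∑-telescope zero    h = sym (-‿inverseʳ (h 0))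
  ∑-telescope (suc n) h = begin
    (h n - h (suc n)) + ∑ (downFrom n) (λ i → h i - h (suc i))  ≈⟨ +-congˡ (∑-telescope n h) ⟩
    (h n - h (suc n)) + (h 0 - h n)                             ≈⟨ +-comm _ _ ⟩
    (h 0 - h n) + (h n - h (suc n))                             ≈⟨ +-assoc (h 0) (- h n) _ ⟩
    h 0 + (- h n + (h n - h (suc n)))                           ≈⟨ +-congˡ (+-assoc (- h n) (h n) _) ⟨
    h 0 + ((- h n + h n) - h (suc n))                           ≈⟨ +-congˡ (+-congʳ (-‿inverseˡ (h n))) ⟩
    h 0 + (0# - h (suc n))                                      ≈⟨ +-congˡ (+-identityˡ _) ⟩
    h 0 - h (suc n)                                             ∎

  -- Both sides are (1 - t ᵏ)(1 - t ⁿ) / (1 - t) applied to h, where t is the shift.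
  ∑-differences : ∀ n k (h : ℕ → Carrier) →
    ∑ (downFrom n) (λ i → h i - h (i ℕ.+ k)) ≈ ∑ (downFrom k) (λ j → h j - h (j ℕ.+ n))
  ∑-differences n zero h = trans
    (∑-cong (downFrom n) λ i →
      trans (+-congˡ (-‿cong (reflexive (≡.cong h (ℕ.+-identityʳ i))))) (-‿inverseʳ (h i)))
    (∑-zero (downFrom n))
  ∑-differences n (suc k) h = begin
    ∑ (downFrom n) (λ i → h i - h (i ℕ.+ suc k))
      ≈⟨ ∑-cong (downFrom n) step ⟩
    ∑ (downFrom n) (λ i → (h⁺ i - h⁺ (suc i)) + (h i - h (i ℕ.+ k)))
      ≈⟨ ∑-+ (downFrom n) _ _ ⟩
    ∑ (downFrom n) (λ i → h⁺ i - h⁺ (suc i)) + ∑ (downFrom n) (λ i → h i - h (i ℕ.+ k))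
      ≈⟨ +-cong (∑-telescope n h⁺) (∑-differences n k h) ⟩
    (h k - h (n ℕ.+ k)) + ∑ (downFrom k) (λ j → h j - h (j ℕ.+ n))
      ≈⟨ +-congʳ (+-congˡ (-‿cong (reflexive (≡.cong h (ℕ.+-comm n k))))) ⟩
    (h k - h (k ℕ.+ n)) + ∑ (downFrom k) (λ j → h j - h (j ℕ.+ n))
      ∎
    where
    h⁺ : ℕ → Carrier
    h⁺ i = h (i ℕ.+ k)

    step : ∀ i → h i - h (i ℕ.+ suc k) ≈ (h⁺ i - h⁺ (suc i)) + (h i - h⁺ i)
    step i = begin
      h i - h (i ℕ.+ suc k)               ≈⟨ +-congˡ (-‿cong (reflexive (≡.cong h (ℕ.+-suc i k)))) ⟩
      h i - h⁺ (suc i)                    ≈⟨ +-congʳ (+-identityʳ (h i)) ⟨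
      (h i + 0#) - h⁺ (suc i)             ≈⟨ +-congʳ (+-congˡ (-‿inverseˡ (h⁺ i))) ⟨
      (h i + (- h⁺ i + h⁺ i)) - h⁺ (suc i) ≈⟨ +-congʳ (+-assoc _ _ _) ⟨
      ((h i - h⁺ i) + h⁺ i) - h⁺ (suc i)  ≈⟨ +-assoc _ _ _ ⟩
      (h i - h⁺ i) + (h⁺ i - h⁺ (suc i))  ≈⟨ +-comm _ _ ⟩
      (h⁺ i - h⁺ (suc i)) + (h i - h⁺ i)  ∎

module ℚ-Sum = ListSum ℚ.+-*-commutativeRing

-- Sums of geometric sequences over a group of translations.

module Elimination {c ℓ} (G : AbelianGroup c ℓ) where

  open AbelianGroup G
  open MonoidMult monoid using () renaming (_×_ to _·_)
  open ℚ-Sum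
  open ≡.≡-Reasoning
  open ℚ-Solver.+-*-Solver

  Sequence : Set c
  Sequence = ℕ → Carrier → ℚ

  Congruent : Sequence → Set _
  Congruent s = ∀ m {u u′} → u ≈ u′ → s m u ≡ s m u′

  -- The ratio is an operator: rational functions on the group form a module over its group ring,
  -- and `v` acts on them by translation.
  Geometric : Carrier → Sequence → Set _
  Geometric v s = ∀ m u → s (suc m) u ≡ s m (u ∙ v)

  -- The weights are absorbed into the summands, so that the index records the ratios alone; this is
  -- what lets `eliminant` be computed from the ratios. The decomposition is a pointwise equation
  -- because functions cannot be compared extensionally.
  data GeometricSum : List Carrier → Sequence → Set (c Level.⊔ ℓ) where
    zero : ∀ {s} → (∀ m u → s m u ≡ 0ℚ) → GeometricSum [] s
    plus : ∀ {v vs s s₁ s₂} → Congruent s₁ → Geometric v s₁ → GeometricSum vs s₂ →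
           (∀ m u → s m u ≡ s₁ m u ℚ.+ s₂ m u) → GeometricSum (v ∷ vs) s

  congruent : ∀ {vs s} → GeometricSum vs s → Congruent s
  congruent (zero s≡0) m u≈u′ = ≡.trans (s≡0 m _) (≡.sym (s≡0 m _))
  congruent (plus s₁-cong _ gs s≡) m u≈u′ = ≡.trans (s≡ m _)
    (≡.trans (≡.cong₂ ℚ._+_ (s₁-cong m u≈u′) (congruent gs m u≈u′)) (≡.sym (s≡ m _)))

  -- One factor `z - τ` of the characteristic polynomial, with `z` the shift of the index and `τ`
  -- translation by `v`.
  Δ : Carrier → Sequence → Sequence
  Δ v s m u = s (suc m) u ℚ.- s m (u ∙ v)

  Δ-+ : ∀ v (s s₁ s₂ : Sequence) → (∀ m u → s m u ≡ s₁ m u ℚ.+ s₂ m u) →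
        ∀ m u → Δ v s m u ≡ Δ v s₁ m u ℚ.+ Δ v s₂ m u
  Δ-+ v s s₁ s₂ s≡ m u = ≡.trans (≡.cong₂ ℚ._-_ (s≡ (suc m) u) (s≡ m (u ∙ v)))
    (solve 4 (λ a b a′ b′ → (a :+ b) :- (a′ :+ b′) := (a :- a′) :+ (b :- b′)) ≡.refl
      (s₁ (suc m) u) (s₂ (suc m) u) (s₁ m (u ∙ v)) (s₂ m (u ∙ v)))

  -- Translations commute with one another and with the shift of the index, so `Δ v` maps a
  -- geometric sequence to one of the same ratio. Commutation in the group holds only up to `≈`,
  -- hence the appeal to `Congruent`.
  Δ-GeometricSum : ∀ v {vs s} → GeometricSum vs s → GeometricSum vs (Δ v s)
  Δ-GeometricSum v (zero s≡0) =
    zero λ m u → ≡.trans (≡.cong₂ ℚ._-_ (s≡0 (suc m) u) (s≡0 m (u ∙ v))) (ℚ.+-inverseʳ 0ℚ)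
  Δ-GeometricSum v (plus {v = w} {s₁ = s₁} {s₂} s₁-cong s₁-geo gs s≡) = plus
    (λ m u≈u′ → ≡.cong₂ ℚ._-_ (s₁-cong (suc m) u≈u′) (s₁-cong m (∙-congʳ u≈u′)))
    (λ m u → ≡.cong₂ ℚ._-_ (s₁-geo (suc m) u)
      (≡.trans (s₁-geo m (u ∙ v)) (s₁-cong m (xy∙z≈xz∙y u v w))))
    (Δ-GeometricSum v gs)
    (Δ-+ v _ s₁ s₂ s≡)
    where open CommutativeSemigroupₚ commutativeSemigroup using (xy∙z≈xz∙y)

  -- Δ v annihilates the geometric sequence of ratio v.
  Δ-cancel : ∀ {v vs s} → GeometricSum (v ∷ vs) s → GeometricSum vs (Δ v s)
  Δ-cancel {v} {s = s} (plus {s₁ = s₁} {s₂} _ s₁-geo gs s≡) = resp (Δ-GeometricSum v gs) λ m u → begin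
    Δ v s m u                  ≡⟨ Δ-+ v s s₁ s₂ s≡ m u ⟩
    Δ v s₁ m u ℚ.+ Δ v s₂ m u  ≡⟨ ≡.cong (λ x → (x ℚ.- s₁ m (u ∙ v)) ℚ.+ Δ v s₂ m u) (s₁-geo m u) ⟩
    (s₁ m (u ∙ v) ℚ.- s₁ m (u ∙ v)) ℚ.+ Δ v s₂ m u
                               ≡⟨ ≡.cong (ℚ._+ Δ v s₂ m u) (ℚ.+-inverseʳ (s₁ m (u ∙ v))) ⟩
    0ℚ ℚ.+ Δ v s₂ m u          ≡⟨ ℚ.+-identityˡ (Δ v s₂ m u) ⟩
    Δ v s₂ m u                 ∎
    where
    resp : ∀ {vs s t} → GeometricSum vs s → (∀ m u → t m u ≡ s m u) → GeometricSum vs t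
    resp (zero s≡0)        t≡s = zero λ m u → ≡.trans (t≡s m u) (s≡0 m u)
    resp (plus c₁ g₁ gs e) t≡s = plus c₁ g₁ gs λ m u → ≡.trans (t≡s m u) (e m u)

  -- A triple (a , m , u) stands for the weight a on the term of index suc m, translated by u.
  eliminant : List Carrier → List (ℚ × ℕ × Carrier)
  eliminant []       = []
  eliminant (v ∷ vs) = (1ℚ , 0 , v ⁻¹) ∷
    concatMap (λ (a , m , u) → (ℚ.- a , suc m , u ∙ v ⁻¹) ∷ (a , m , u) ∷ []) (eliminant vs)

  -- Solving the definition of `Δ v s 0` at `u ∙ v ⁻¹` for its second term gives `s 0 u` as
  -- `s 1 (u ∙ v ⁻¹)` minus `Δ v s 0 (u ∙ v ⁻¹)`. Here translation by `v` is inverted. By `Δ-cancel`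
  -- the sequence `Δ v s` has one ratio fewer, and the recursive call expresses its term of index 0
  -- by terms of positive index, which unfold to terms of `s` of positive index.
  eliminate : ∀ {vs s} → GeometricSum vs s → ∀ u →
              s 0 u ≡ ∑ (eliminant vs) (λ (a , m , w) → a ℚ.* s (suc m) (u ∙ w))
  eliminate                  (zero s≡0)         u = s≡0 0 u
  eliminate {v ∷ vs} {s} gs@(plus _ _ _ _) u = begin
    s 0 u
      ≡⟨ congruent gs 0 (xy⁻¹y≈x u v) ⟨
    s 0 (u ∙ v ⁻¹ ∙ v)
      ≡⟨ solve 2 (λ a b → b := con 1ℚ :* a :- (a :- b)) ≡.refl (s 1 (u ∙ v ⁻¹)) (s 0 (u ∙ v ⁻¹ ∙ v)) ⟩
    1ℚ ℚ.* s 1 (u ∙ v ⁻¹) ℚ.- Δ v s 0 (u ∙ v ⁻¹)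
      ≡⟨ ≡.cong (λ x → 1ℚ ℚ.* s 1 (u ∙ v ⁻¹) ℚ.- x) (eliminate (Δ-cancel gs) (u ∙ v ⁻¹)) ⟩
    1ℚ ℚ.* s 1 (u ∙ v ⁻¹) ℚ.- ∑ (eliminant vs) old
      ≡⟨ ≡.cong (1ℚ ℚ.* s 1 (u ∙ v ⁻¹) ℚ.+_) (∑-neg (eliminant vs) old) ⟨
    1ℚ ℚ.* s 1 (u ∙ v ⁻¹) ℚ.+ ∑ (eliminant vs) (λ e → ℚ.- old e)
      ≡⟨ ≡.cong (1ℚ ℚ.* s 1 (u ∙ v ⁻¹) ℚ.+_) (∑-cong (eliminant vs) old≡new) ⟩
    1ℚ ℚ.* s 1 (u ∙ v ⁻¹) ℚ.+ ∑ (eliminant vs) (λ e → ∑ (pair e) new)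
      ≡⟨ ≡.cong (1ℚ ℚ.* s 1 (u ∙ v ⁻¹) ℚ.+_) (∑-concatMap pair (eliminant vs) new) ⟨
    ∑ (eliminant (v ∷ vs)) new
      ∎
    where
    xy⁻¹y≈x : ∀ x y → x ∙ y ⁻¹ ∙ y ≈ x
    xy⁻¹y≈x x y = trans (assoc x (y ⁻¹) y) (trans (∙-congˡ (inverseˡ y)) (identityʳ x))

    open CommutativeSemigroupₚ commutativeSemigroup using (xy∙z≈xz∙y)

    pair : ℚ × ℕ × Carrier → List (ℚ × ℕ × Carrier)
    pair (a , m , w) = (ℚ.- a , suc m , w ∙ v ⁻¹) ∷ (a , m , w) ∷ []

    old new : ℚ × ℕ × Carrier → ℚ
    old (a , m , w) = a ℚ.* Δ v s (suc m) (u ∙ v ⁻¹ ∙ w)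
    new (a , m , w) = a ℚ.* s (suc m) (u ∙ w)

    -- Each term of the recursive call unfolds into two terms of `s`. In the second, the translation
    -- by `v` inside `Δ v` undoes `v ⁻¹`, which is why `pair` keeps `w` and `m` unchanged there.
    old≡new : ∀ e → ℚ.- old e ≡ ∑ (pair e) new
    old≡new (a , m , w) = begin
      ℚ.- (a ℚ.* Δ v s (suc m) (u ∙ v ⁻¹ ∙ w))
        ≡⟨ ≡.cong₂ (λ x y → ℚ.- (a ℚ.* (x ℚ.- y)))
             (congruent gs _ (trans (xy∙z≈xz∙y u (v ⁻¹) w) (assoc u w (v ⁻¹))))
             (congruent gs _ (trans (∙-congʳ (xy∙z≈xz∙y u (v ⁻¹) w)) (xy⁻¹y≈x (u ∙ w) v))) ⟩
      ℚ.- (a ℚ.* (s (suc (suc m)) (u ∙ (w ∙ v ⁻¹)) ℚ.- s (suc m) (u ∙ w)))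
        ≡⟨ solve 3 (λ a x y → :- (a :* (x :- y)) := (:- a) :* x :+ (a :* y :+ con 0ℚ)) ≡.refl
             a (s (suc (suc m)) (u ∙ (w ∙ v ⁻¹))) (s (suc m) (u ∙ w)) ⟩
      ∑ (pair (a , m , w)) new
        ∎

  -- The sequence `s` of the overview, seen from one fixed point of the plane: `φ` is later the
  -- value at that point as a function of the corner of the square, so that translating the square
  -- becomes addition in the group.
  dilate : List (ℚ × Carrier) → (Carrier → ℚ) → Sequence
  dilate ws φ m u = ∑ ws (λ (c , v) → c ℚ.* φ (u ∙ m · v))

  dilate-GeometricSum : ∀ ws φ → (∀ {u u′} → u ≈ u′ → φ u ≡ φ u′) →
                        GeometricSum (map proj₂ ws) (dilate ws φ)
  dilate-GeometricSum []             φ φ-cong = zero λ _ _ → ≡.refl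
  dilate-GeometricSum ((c , v) ∷ ws) φ φ-cong = plus
    (λ m u≈u′ → ≡.cong (c ℚ.*_) (φ-cong (∙-congʳ u≈u′)))
    (λ m u → ≡.cong (c ℚ.*_) (φ-cong (sym (assoc u v (m · v)))))
    (dilate-GeometricSum ws φ φ-cong)
    (λ _ _ → ≡.refl)

  -- At index 0 the multiples of all the `v` vanish, so every summand evaluates `φ` at the same
  -- place.
  dilate-0 : ∀ ws φ → (∀ {u u′} → u ≈ u′ → φ u ≡ φ u′) →
             ∀ u → dilate ws φ 0 u ≡ ∑ ws proj₁ ℚ.* φ u
  dilate-0 ws φ φ-cong u = ≡.trans
    (∑-cong ws λ (c , v) → ≡.cong (c ℚ.*_) (φ-cong (identityʳ u)))
    (≡.sym (∑-distribʳ (φ u) ws proj₁))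

-- The integers and rationals inside the real field.

module RealArithmetic {c ℓ₁ ℓ₂} (ℝ : RealNumbers c ℓ₁ ℓ₂) where

  open RealNumbers ℝ
  open RealProperties ℝ
  open SemiringMult semiring using (×-homo-+; ×1-homo-*) renaming (_×_ to _·_)
  open Ringₚ ring using (-‿distribˡ-*; -‿distribʳ-*; -‿involutive; -0#≈0#; -‿+-comm; +-inverseʳ-unique)
  open ≈-Reasoning setoid

  fromℤ-⊖ : ∀ m n → fromℤ (m ⊖ n) ≈ m · 1# - n · 1#
  fromℤ-⊖ m       zero    = sym (trans (+-congˡ -0#≈0#) (+-identityʳ _))
  fromℤ-⊖ zero    (suc n) = sym (+-identityˡ _)
  fromℤ-⊖ (suc m) (suc n) = begin
    fromℤ (suc m ⊖ suc n)             ≡⟨ ≡.cong fromℤ (ℤ.[1+m]⊖[1+n]≡m⊖n m n) ⟩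
    fromℤ (m ⊖ n)                     ≈⟨ fromℤ-⊖ m n ⟩
    m · 1# - n · 1#                   ≈⟨ +-congʳ (x+z-z≈x _ 1#) ⟨
    ((m · 1# + 1#) - 1#) - n · 1#     ≈⟨ +-assoc _ _ _ ⟩
    (m · 1# + 1#) + (- 1# - n · 1#)   ≈⟨ +-cong (+-comm _ _) (-‿+-comm 1# (n · 1#)) ⟩
    suc m · 1# - suc n · 1#           ∎

  fromℤ-neg : ∀ i → fromℤ (ℤ.- i) ≈ - fromℤ i
  fromℤ-neg (+ zero)  = sym -0#≈0#
  fromℤ-neg (+ suc n) = refl
  fromℤ-neg -[1+ n ]  = sym (-‿involutive _)

  fromℤ-+ : ∀ i j → fromℤ (i ℤ.+ j) ≈ fromℤ i + fromℤ j
  fromℤ-+ (+ m)    (+ n)    = ×-homo-+ 1# m n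
  fromℤ-+ (+ m)    -[1+ n ] = fromℤ-⊖ m (suc n)
  fromℤ-+ -[1+ m ] (+ n)    = trans (fromℤ-⊖ n (suc m)) (+-comm _ _)
  fromℤ-+ -[1+ m ] -[1+ n ] = begin
    - (suc (suc (m ℕ.+ n)) · 1#)      ≡⟨ ≡.cong (λ k → - (suc k · 1#)) (≡.sym (ℕ.+-suc m n)) ⟩
    - ((suc m ℕ.+ suc n) · 1#)        ≈⟨ -‿cong (×-homo-+ 1# (suc m) (suc n)) ⟩
    - (suc m · 1# + suc n · 1#)       ≈⟨ -‿+-comm _ _ ⟨
    - (suc m · 1#) - suc n · 1#       ∎

  fromℤ-pos-* : ∀ m j → fromℤ (+ m ℤ.* j) ≈ fromℤ (+ m) * fromℤ j
  fromℤ-pos-* m (+ n)    = trans (reflexive (≡.cong fromℤ (≡.sym (ℤ.pos-* m n)))) (×1-homo-* m n)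
  fromℤ-pos-* m -[1+ n ] = begin
    fromℤ (+ m ℤ.* -[1+ n ])           ≡⟨ ≡.cong fromℤ (ℤ.neg-distribʳ-* (+ m) (+ suc n)) ⟨
    fromℤ (ℤ.- (+ m ℤ.* + suc n))      ≈⟨ fromℤ-neg (+ m ℤ.* + suc n) ⟩
    - fromℤ (+ m ℤ.* + suc n)          ≈⟨ -‿cong (fromℤ-pos-* m (+ suc n)) ⟩
    - (fromℤ (+ m) * fromℤ (+ suc n))  ≈⟨ -‿distribʳ-* _ _ ⟩
    fromℤ (+ m) * fromℤ -[1+ n ]       ∎

  fromℤ-* : ∀ i j → fromℤ (i ℤ.* j) ≈ fromℤ i * fromℤ j
  fromℤ-* (+ m)    j = fromℤ-pos-* m j
  fromℤ-* -[1+ m ] j = begin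
    fromℤ (-[1+ m ] ℤ.* j)             ≡⟨ ≡.cong fromℤ (ℤ.neg-distribˡ-* (+ suc m) j) ⟨
    fromℤ (ℤ.- (+ suc m ℤ.* j))        ≈⟨ fromℤ-neg (+ suc m ℤ.* j) ⟩
    - fromℤ (+ suc m ℤ.* j)            ≈⟨ -‿cong (fromℤ-pos-* (suc m) j) ⟩
    - (fromℤ (+ suc m) * fromℤ j)      ≈⟨ -‿distribˡ-* _ _ ⟩
    fromℤ -[1+ m ] * fromℤ j           ∎

  fromℤ-morphism : ℤ.+-*-rawRing -Raw-AlmostCommutative⟶ fromCommutativeRing commutativeRing
  fromℤ-morphism = record
    { ⟦_⟧    = fromℤ
    ; +-homo = fromℤ-+
    ; *-homo = fromℤ-*
    ; -‿homo = fromℤ-neg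
    ; 0-homo = refl
    ; 1-homo = +-identityʳ 1#
    }

  fromℤ-≟ : ∀ i j → Maybe (fromℤ i ≈ fromℤ j)
  fromℤ-≟ i j = Maybe.map (reflexive ∘ ≡.cong fromℤ) (dec⇒weaklyDec ℤ._≟_ i j)

  module Solver =
    RingSolver ℤ.+-*-rawRing (fromCommutativeRing commutativeRing) fromℤ-morphism fromℤ-≟

  x-y>0 : ∀ {x y} → x < y → 0# < y - x
  x-y>0 {x} x<y = <-resp (-‿inverseʳ x) refl (+-monoˡ-< (- x) x<y)

  0<[1+n]·1 : ∀ n → 0# < suc n · 1#
  0<[1+n]·1 zero    = <-resp refl (sym (+-identityʳ 1#)) 0<1
  0<[1+n]·1 (suc n) = <.trans (0<[1+n]·1 n)
    (<-resp (+-identityˡ _) refl (+-monoˡ-< (suc n · 1#) 0<1))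

  0<x⇒x≉0 : ∀ {x} → 0# < x → ¬ x ≈ 0#
  0<x⇒x≉0 0<x x≈0 = <.irrefl (sym x≈0) 0<x

  0<⁻¹ : ∀ {x} → 0# < x → 0# < x ⁻¹
  0<⁻¹ {x} 0<x = *-cancelˡ-< 0<x
    (<-resp (sym (zeroʳ x)) (sym (⁻¹-inverseʳ (0<x⇒x≉0 0<x))) 0<1)

  *-cancelʳ-nonZero : ∀ {x y z} → ¬ z ≈ 0# → x * z ≈ y * z → x ≈ y
  *-cancelʳ-nonZero {x} {y} {z} z≉0 xz≈yz = begin
    x                ≈⟨ *-identityʳ x ⟨
    x * 1#           ≈⟨ *-congˡ (⁻¹-inverseʳ z≉0) ⟨
    x * (z * z ⁻¹)   ≈⟨ *-assoc _ _ _ ⟨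
    x * z * z ⁻¹     ≈⟨ *-congʳ xz≈yz ⟩
    y * z * z ⁻¹     ≈⟨ *-assoc _ _ _ ⟩
    y * (z * z ⁻¹)   ≈⟨ *-congˡ (⁻¹-inverseʳ z≉0) ⟩
    y * 1#           ≈⟨ *-identityʳ y ⟩
    y                ∎

  ↧≉0 : ∀ q → ¬ fromℤ (↧ q) ≈ 0#
  ↧≉0 q = 0<x⇒x≉0 (0<[1+n]·1 (ℚ.ℚ.denominator-1 q))

  fromℚ-↧ : ∀ q → fromℚ q * fromℤ (↧ q) ≈ fromℤ (↥ q)
  fromℚ-↧ q = begin
    (fromℤ (↥ q) * fromℤ (↧ q) ⁻¹) * fromℤ (↧ q)  ≈⟨ *-assoc _ _ _ ⟩
    fromℤ (↥ q) * (fromℤ (↧ q) ⁻¹ * fromℤ (↧ q))  ≈⟨ *-congˡ (*-comm _ _) ⟩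
    fromℤ (↥ q) * (fromℤ (↧ q) * fromℤ (↧ q) ⁻¹)  ≈⟨ *-congˡ (⁻¹-inverseʳ (↧≉0 q)) ⟩
    fromℤ (↥ q) * 1#                              ≈⟨ *-identityʳ _ ⟩
    fromℤ (↥ q)                                   ∎

  fromℚ-unique : ∀ q {x} → x * fromℤ (↧ q) ≈ fromℤ (↥ q) → fromℚ q ≈ x
  fromℚ-unique q eq = *-cancelʳ-nonZero (↧≉0 q) (trans (fromℚ-↧ q) (sym eq))

  -- Sums and products in `ℚ` are reduced to lowest terms, which hides their numerators and
  -- denominators. Comparison with an unnormalised fraction by cross-multiplication avoids any
  -- reasoning about the gcd.
  fromℚ-uniqueᵘ : ∀ q p {x} → toℚᵘ q ℚᵘ.≃ p → x * fromℤ (ℚᵘ.↧ p) ≈ fromℤ (ℚᵘ.↥ p) → fromℚ q ≈ x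
  fromℚ-uniqueᵘ q@record{} p {x} (ℚᵘ.*≡* q≃p) eq = fromℚ-unique q
    (*-cancelʳ-nonZero (0<x⇒x≉0 (0<[1+n]·1 (ℚᵘ.ℚᵘ.denominator-1 p))) (begin
      x * fromℤ (↧ q) * fromℤ (ℚᵘ.↧ p)     ≈⟨ *-assoc _ _ _ ⟩
      x * (fromℤ (↧ q) * fromℤ (ℚᵘ.↧ p))   ≈⟨ *-congˡ (*-comm _ _) ⟩
      x * (fromℤ (ℚᵘ.↧ p) * fromℤ (↧ q))   ≈⟨ *-assoc _ _ _ ⟨
      x * fromℤ (ℚᵘ.↧ p) * fromℤ (↧ q)     ≈⟨ *-congʳ eq ⟩
      fromℤ (ℚᵘ.↥ p) * fromℤ (↧ q)         ≈⟨ fromℤ-* (ℚᵘ.↥ p) (↧ q) ⟨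
      fromℤ (ℚᵘ.↥ p ℤ.* ↧ q)               ≡⟨ ≡.cong fromℤ q≃p ⟨
      fromℤ (↥ q ℤ.* ℚᵘ.↧ p)               ≈⟨ fromℤ-* (↥ q) (ℚᵘ.↧ p) ⟩
      fromℤ (↥ q) * fromℤ (ℚᵘ.↧ p)         ∎))

  fromℚ-+ : ∀ p q → fromℚ (p ℚ.+ q) ≈ fromℚ p + fromℚ q
  fromℚ-+ p@record{} q@record{} = fromℚ-uniqueᵘ (p ℚ.+ q) (toℚᵘ p ℚᵘ.+ toℚᵘ q)
    (ℚ.toℚᵘ-homo-+ p q) (begin
    (fromℚ p + fromℚ q) * fromℤ (↧ p ℤ.* ↧ q)
      ≈⟨ *-congˡ (fromℤ-* (↧ p) (↧ q)) ⟩
    (fromℚ p + fromℚ q) * (fromℤ (↧ p) * fromℤ (↧ q))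
      ≈⟨ solve 4 (λ a b c d → (a :+ b) :* (c :* d) := (a :* c) :* d :+ (b :* d) :* c) refl _ _ _ _ ⟩
    (fromℚ p * fromℤ (↧ p)) * fromℤ (↧ q) + (fromℚ q * fromℤ (↧ q)) * fromℤ (↧ p)
      ≈⟨ +-cong (*-congʳ (fromℚ-↧ p)) (*-congʳ (fromℚ-↧ q)) ⟩
    fromℤ (↥ p) * fromℤ (↧ q) + fromℤ (↥ q) * fromℤ (↧ p)
      ≈⟨ +-cong (fromℤ-* (↥ p) (↧ q)) (fromℤ-* (↥ q) (↧ p)) ⟨
    fromℤ (↥ p ℤ.* ↧ q) + fromℤ (↥ q ℤ.* ↧ p)
      ≈⟨ fromℤ-+ (↥ p ℤ.* ↧ q) (↥ q ℤ.* ↧ p) ⟨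
    fromℤ (↥ p ℤ.* ↧ q ℤ.+ ↥ q ℤ.* ↧ p)
      ∎)
    where open Solver

  fromℚ-* : ∀ p q → fromℚ (p ℚ.* q) ≈ fromℚ p * fromℚ q
  fromℚ-* p@record{} q@record{} = fromℚ-uniqueᵘ (p ℚ.* q) (toℚᵘ p ℚᵘ.* toℚᵘ q)
    (ℚ.toℚᵘ-homo-* p q) (begin
    fromℚ p * fromℚ q * fromℤ (↧ p ℤ.* ↧ q)
      ≈⟨ *-congˡ (fromℤ-* (↧ p) (↧ q)) ⟩
    fromℚ p * fromℚ q * (fromℤ (↧ p) * fromℤ (↧ q))
      ≈⟨ solve 4 (λ a b c d → a :* b :* (c :* d) := (a :* c) :* (b :* d)) refl _ _ _ _ ⟩
    (fromℚ p * fromℤ (↧ p)) * (fromℚ q * fromℤ (↧ q))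
      ≈⟨ *-cong (fromℚ-↧ p) (fromℚ-↧ q) ⟩
    fromℤ (↥ p) * fromℤ (↥ q)
      ≈⟨ fromℤ-* (↥ p) (↥ q) ⟨
    fromℤ (↥ p ℤ.* ↥ q)
      ∎)
    where open Solver

  fromℚ-0 : fromℚ 0ℚ ≈ 0#
  fromℚ-0 = fromℚ-unique 0ℚ (zeroˡ _)

  fromℚ-1 : fromℚ 1ℚ ≈ 1#
  fromℚ-1 = fromℚ-unique 1ℚ (*-identityˡ _)

  fromℚ-neg : ∀ q → fromℚ (ℚ.- q) ≈ - fromℚ q
  fromℚ-neg q = +-inverseʳ-unique _ _ (begin
    fromℚ q + fromℚ (ℚ.- q)  ≈⟨ fromℚ-+ q (ℚ.- q) ⟨
    fromℚ (q ℚ.- q)          ≡⟨ ≡.cong fromℚ (ℚ.+-inverseʳ q) ⟩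
    fromℚ 0ℚ                 ≈⟨ fromℚ-0 ⟩
    0#                       ∎)

  fromℚ-- : ∀ p q → fromℚ (p ℚ.- q) ≈ fromℚ p - fromℚ q
  fromℚ-- p q = trans (fromℚ-+ p (ℚ.- q)) (+-congˡ (fromℚ-neg q))

  -- Applied to side lengths, whose numerators must be natural numbers in order to count cells.
  positive-rational : ∀ q → 0# < fromℚ q → ∃ λ n → fromℚ q * fromℤ (↧ q) ≈ n · 1#
  positive-rational q@(mkℚ (+ n)    _ _) 0<q = n , fromℚ-↧ q
  positive-rational q@(mkℚ -[1+ n ] d _) 0<q = contradiction
    (<-resp (+-identityˡ _) (-‿inverseʳ _)
      (+-monoˡ-< (- (suc n · 1#)) (0<[1+n]·1 n)))
    (<.asym (<-resp refl (fromℚ-↧ q) (*-pos 0<q (0<[1+n]·1 d))))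

  open ListSum commutativeRing using (∑)

  fromℚ-∑ : ∀ {a} {A : Set a} xs (f : A → ℚ) → fromℚ (ℚ-Sum.∑ xs f) ≈ ∑ xs (fromℚ ∘ f)
  fromℚ-∑ []       f = fromℚ-0
  fromℚ-∑ (x ∷ xs) f = trans (fromℚ-+ (f x) _) (+-congˡ (fromℚ-∑ xs f))

-- Tiles as linear combinations of products of step functions.

module Indicators {c ℓ₁ ℓ₂} (ℝ : RealNumbers c ℓ₁ ℓ₂) where

  open Tiling ℝ

  ≰⇒> : ∀ {x y} → ¬ x ≤ y → y < x
  ≰⇒> {x} {y} x≰y with <.compare x y
  ... | tri< x<y _ _ = contradiction (inj₁ x<y) x≰y
  ... | tri≈ _ x≈y _ = contradiction (inj₂ x≈y) x≰y
  ... | tri> _ _ y<x = y<x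

  ≮⇒≥ : ∀ {x y} → ¬ x < y → y ≤ x
  ≮⇒≥ {x} {y} x≮y with <.compare x y
  ... | tri< x<y _ _ = contradiction x<y x≮y
  ... | tri≈ _ x≈y _ = inj₂ (sym x≈y)
  ... | tri> _ _ y<x = inj₁ y<x

  <-≤-trans : ∀ {x y z} → x < y → y ≤ z → x < z
  <-≤-trans x<y (inj₁ y<z) = <.trans x<y y<z
  <-≤-trans x<y (inj₂ y≈z) = <-resp refl y≈z x<y

  <⇒≱ : ∀ {x y} → x < y → ¬ y ≤ x
  <⇒≱ x<y y≤x = <.irrefl refl (<-≤-trans x<y y≤x)

  step : Carrier → Carrier → ℚ
  step a x = if does (a ≤? x) then 1ℚ else 0ℚ

  step-≤ : ∀ {a x} → a ≤ x → step a x ≡ 1ℚ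
  step-≤ {a} {x} a≤x = ≡.cong (if_then 1ℚ else 0ℚ) (dec-true (a ≤? x) a≤x)

  step-> : ∀ {a x} → x < a → step a x ≡ 0ℚ
  step-> {a} {x} x<a = ≡.cong (if_then 1ℚ else 0ℚ) (dec-false (a ≤? x) (<⇒≱ x<a))

  step-cong : ∀ {a a′ x} → a ≈ a′ → step a x ≡ step a′ x
  step-cong {a} {a′} {x} a≈a′ with a ≤? x
  ... | yes a≤x = ≡.trans (step-≤ a≤x) (≡.sym (step-≤ (≤-resp a≈a′ refl a≤x)))
  ... | no  a≰x = ≡.trans (step-> (≰⇒> a≰x)) (≡.sym (step-> (<-resp refl a≈a′ (≰⇒> a≰x))))

  -- A difference of steps instead of a membership test: sums over adjacent intervals then
  -- telescope, and the length of the interval is, up to sign, the same difference with each step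
  -- replaced by its position.
  indicatorᴵ : Interval → Carrier → ℚ
  indicatorᴵ I x = step lo x ℚ.- step hi x
    where open Interval I

  indicator : Rectangle → Point → ℚ
  indicator R (x , y) = indicatorᴵ horizontal x ℚ.* indicatorᴵ vertical y
    where open Rectangle R

  indicatorᴵ-∈ : ∀ I {x} → x ∈ᴵ I → indicatorᴵ I x ≡ 1ℚ
  indicatorᴵ-∈ I (lo≤x , x<hi) = ≡.cong₂ ℚ._-_ (step-≤ lo≤x) (step-> x<hi)

  indicatorᴵ-∉ : ∀ I {x} → ¬ x ∈ᴵ I → indicatorᴵ I x ≡ 0ℚ
  indicatorᴵ-∉ I {x} x∉I with Interval.lo I ≤? x
  ... | no  lo≰x = ≡.cong₂ ℚ._-_ (step-> (≰⇒> lo≰x)) (step-> (<.trans (≰⇒> lo≰x) (Interval.lo<hi I)))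
  ... | yes lo≤x = ≡.cong₂ ℚ._-_ (step-≤ lo≤x) (step-≤ (≮⇒≥ λ x<hi → x∉I (lo≤x , x<hi)))

  indicator-∈ : ∀ R {p} → p ∈ᴿ R → indicator R p ≡ 1ℚ
  indicator-∈ R (x∈ , y∈) =
    ≡.cong₂ ℚ._*_ (indicatorᴵ-∈ horizontal x∈) (indicatorᴵ-∈ vertical y∈)
    where open Rectangle R

  indicator-∉ : ∀ R {p} → ¬ p ∈ᴿ R → indicator R p ≡ 0ℚ
  indicator-∉ R {x , y} p∉R with b₁ ≤? x | x <.<? b₂
    where open Rectangle R
  ... | yes b₁≤x | yes x<b₂ =
    ≡.trans (≡.cong (indicatorᴵ horizontal x ℚ.*_)
              (indicatorᴵ-∉ vertical λ y∈ → p∉R ((b₁≤x , x<b₂) , y∈)))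
            (ℚ.*-zeroʳ (indicatorᴵ horizontal x))
    where open Rectangle R
  ... | no b₁≰x | _ =
    ≡.trans (≡.cong (ℚ._* indicatorᴵ vertical y) (indicatorᴵ-∉ horizontal (b₁≰x ∘ proj₁)))
            (ℚ.*-zeroˡ (indicatorᴵ vertical y))
    where open Rectangle R
  ... | yes _ | no x≮b₂ =
    ≡.trans (≡.cong (ℚ._* indicatorᴵ vertical y) (indicatorᴵ-∉ horizontal (x≮b₂ ∘ proj₂)))
            (ℚ.*-zeroˡ (indicatorᴵ vertical y))
    where open Rectangle R

  pieceValue : Point → Piece → ℚ
  pieceValue p (a , R) = a ℚ.* indicator R p

  -- `valueOf` stops at the first rectangle that contains the point; by disjointness all later
  -- summands are zero there. From here on tiles can be handled linearly.
  valueOf-∑ : ∀ {Ps} → AllPairs (λ P Q → Disjoint (proj₂ P) (proj₂ Q)) Ps → ∀ p →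
              valueOf Ps p ≡ ℚ-Sum.∑ Ps (pieceValue p)
  valueOf-∑ []                             p = ≡.refl
  valueOf-∑ {(a , R) ∷ Ps} (disj ∷ disjs) p with p ∈ᴿ? R
  ... | yes p∈R = begin
    valueOf ((a , R) ∷ Ps) p
      ≡⟨ ≡.cong (if_then a else valueOf Ps p) (dec-true (p ∈ᴿ? R) p∈R) ⟩
    a
      ≡⟨ solve 1 (λ a → a := a :* con 1ℚ :+ con 0ℚ) ≡.refl a ⟩
    a ℚ.* 1ℚ ℚ.+ 0ℚ
      ≡⟨ ≡.cong₂ (λ x y → a ℚ.* x ℚ.+ y) (indicator-∈ R p∈R) rest≡0 ⟨
    a ℚ.* indicator R p ℚ.+ ℚ-Sum.∑ Ps (pieceValue p)
      ∎
    where
    open ≡.≡-Reasoning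
    open ℚ-Solver.+-*-Solver
    rest≡0 : ℚ-Sum.∑ Ps (pieceValue p) ≡ 0ℚ
    rest≡0 = ≡.trans
      (ℚ-Sum.∑-congᴬ (All.map (λ {(a , S)} R∩S=∅ →
        ≡.trans (≡.cong (a ℚ.*_) (indicator-∉ S (R∩S=∅ p p∈R))) (ℚ.*-zeroʳ a)) disj))
      (ℚ-Sum.∑-zero Ps)
  ... | no p∉R = begin
    valueOf ((a , R) ∷ Ps) p
      ≡⟨ ≡.cong (if_then a else valueOf Ps p) (dec-false (p ∈ᴿ? R) p∉R) ⟩
    valueOf Ps p
      ≡⟨ valueOf-∑ disjs p ⟩
    ℚ-Sum.∑ Ps (pieceValue p)
      ≡⟨ solve 2 (λ a x → x := a :* con 0ℚ :+ x) ≡.refl a _ ⟩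
    a ℚ.* 0ℚ ℚ.+ ℚ-Sum.∑ Ps (pieceValue p)
      ≡⟨ ≡.cong (λ x → a ℚ.* x ℚ.+ ℚ-Sum.∑ Ps (pieceValue p)) (indicator-∉ R p∉R) ⟨
    a ℚ.* indicator R p ℚ.+ ℚ-Sum.∑ Ps (pieceValue p)
      ∎
    where
    open ≡.≡-Reasoning
    open ℚ-Solver.+-*-Solver

  place : PositiveReal → Point → Rectangle → Rectangle
  place ρ v R = translateᴿ v (rescaleᴿ ρ R)

  value-place : ∀ T ρ v p → value (translate v (rescale ρ T)) p ≡
                ℚ-Sum.∑ (Tile.pieces T) (λ (a , R) → a ℚ.* indicator (place ρ v R) p)
  value-place T ρ v p = begin
    value (translate v (rescale ρ T)) p
      ≡⟨ valueOf-∑ (Tile.disjoint (translate v (rescale ρ T))) p ⟩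
    ∑ (map (map₂ (translateᴿ v)) (map (map₂ (rescaleᴿ ρ)) (Tile.pieces T))) (pieceValue p)
      ≡⟨ ∑-map (map₂ (translateᴿ v)) (map (map₂ (rescaleᴿ ρ)) (Tile.pieces T)) (pieceValue p) ⟩
    ∑ (map (map₂ (rescaleᴿ ρ)) (Tile.pieces T)) (pieceValue p ∘ map₂ (translateᴿ v))
      ≡⟨ ∑-map (map₂ (rescaleᴿ ρ)) (Tile.pieces T) (pieceValue p ∘ map₂ (translateᴿ v)) ⟩
    ∑ (Tile.pieces T) (λ (a , R) → a ℚ.* indicator (place ρ v R) p)
      ∎
    where
    open ≡.≡-Reasoning
    open ℚ-Sum

  combination-∑ : ∀ T (placed : List (ℚ × PositiveReal × Point)) p →
    combination (map (map₂ λ (ρ , v) → translate v (rescale ρ T)) placed) p ≡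
    ℚ-Sum.∑ placed (λ (a , ρ , v) → a ℚ.* value (translate v (rescale ρ T)) p)
  combination-∑ T placed p = ℚ-Sum.∑-map (map₂ λ (ρ , v) → translate v (rescale ρ T)) placed
    (λ (a , U) → a ℚ.* value U p)

  -- A bare list of pieces, because the lists of several copies are going to be concatenated and
  -- their rectangles may overlap.
  copy : Tile → ℚ × PositiveReal × Point → List Piece
  copy T (a , ρ , v) = map (λ (c , R) → a ℚ.* c , place ρ v R) (Tile.pieces T)

  value-copy : ∀ T a ρ v p → ℚ-Sum.∑ (copy T (a , ρ , v)) (pieceValue p) ≡
               a ℚ.* value (translate v (rescale ρ T)) p
  value-copy T a ρ v p = begin
    ∑ (copy T (a , ρ , v)) (pieceValue p)
      ≡⟨ ∑-map (λ (c , R) → a ℚ.* c , place ρ v R) (Tile.pieces T) (pieceValue p) ⟩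
    ∑ (Tile.pieces T) (λ (c , R) → a ℚ.* c ℚ.* indicator (place ρ v R) p)
      ≡⟨ ∑-cong (Tile.pieces T) (λ (c , R) → ℚ.*-assoc a c _) ⟩
    ∑ (Tile.pieces T) (λ (c , R) → a ℚ.* (c ℚ.* indicator (place ρ v R) p))
      ≡⟨ ∑-distribˡ a (Tile.pieces T) _ ⟨
    a ℚ.* ∑ (Tile.pieces T) (λ (c , R) → c ℚ.* indicator (place ρ v R) p)
      ≡⟨ ≡.cong (a ℚ.*_) (value-place T ρ v p) ⟨
    a ℚ.* value (translate v (rescale ρ T)) p
      ∎
    where
    open ≡.≡-Reasoning
    open ℚ-Sum

  value-rectangleTile : ∀ S p → value (rectangleTile S) p ≡ indicator S p
  value-rectangleTile S p = ≡.trans (valueOf-∑ (Tile.disjoint (rectangleTile S)) p)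
    (solve 1 (λ x → con 1ℚ :* x :+ con 0ℚ := x) ≡.refl _)
    where open ℚ-Solver.+-*-Solver

-- Weighted area is determined by the function on the plane.

module Area {c ℓ₁ ℓ₂} (ℝ : RealNumbers c ℓ₁ ℓ₂) where

  open Tiling ℝ
  open RealArithmetic ℝ
  open Indicators ℝ
  open ListSum commutativeRing
  open Ringₚ ring using (-0#≈0#; -‿distribˡ-*)
  open ≈-Reasoning setoid

  -- A pair `(d , b)` stands for `d` times the step at `b`. The coefficient is real because the
  -- weights in `areas-vanish` include widths.
  Jump : Set c
  Jump = Carrier × Carrier

  jumpAt : Carrier → Jump → Carrier
  jumpAt b (d , b′) = if does (b′ <.≟ b) then d else 0#

  jumpAt-≈ : ∀ {b b′} d → b′ ≈ b → jumpAt b (d , b′) ≡ d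
  jumpAt-≈ {b} {b′} d b′≈b = ≡.cong (if_then d else 0#) (dec-true (b′ <.≟ b) b′≈b)

  jumpAt-≉ : ∀ {b b′} d → ¬ b′ ≈ b → jumpAt b (d , b′) ≡ 0#
  jumpAt-≉ {b} {b′} d b′≉b = ≡.cong (if_then d else 0#) (dec-false (b′ <.≟ b) b′≉b)

  away : Carrier → List Jump → List Jump
  away b = filter λ (_ , b′) → ¬? (b′ <.≟ b)

  -- Used for two choices of `φ`: the step at position `b` evaluated at a fixed point, and the
  -- identity. The same splitting of the list thus serves for the hypothesis and for the conclusion
  -- of `firstMoment-vanishes`.
  ∑-away : ∀ b xs (φ : Carrier → Carrier) → (∀ {x y} → x ≈ y → φ x ≈ φ y) →
           ∑ xs (λ (d , b′) → d * φ b′) ≈ ∑ xs (jumpAt b) * φ b + ∑ (away b xs) (λ (d , b′) → d * φ b′)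
  ∑-away b []              φ φ-cong = sym (trans (+-identityʳ _) (zeroˡ (φ b)))
  ∑-away b ((d , b′) ∷ xs) φ φ-cong with b′ <.≟ b
  ... | yes b′≈b = trans (+-cong (*-congˡ (φ-cong b′≈b)) (∑-away b xs φ φ-cong))
    (solve 4 (λ d j f s → d :* f :+ (j :* f :+ s) := (d :+ j) :* f :+ s) refl d _ (φ b) _)
    where open Solver
  ... | no  b′≉b = trans (+-congˡ (∑-away b xs φ φ-cong))
    (solve 4 (λ x j f s → x :+ (j :* f :+ s) := (con ℤ.0ℤ :+ j) :* f :+ (x :+ s))
      refl (d * φ b′) _ (φ b) _)
    where
    open Solver

  -- Supplies a left neighbour of `b`: no position lies strictly between `y` and `b`.
  gapBelow : ∀ b (xs : List Jump) → ∃ λ y → y < b × All (λ (_ , b′) → b′ < b → b′ ≤ y) xs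
  gapBelow b []              = b - 1# ,
    <-resp (+-identityˡ _) (trans (+-comm 1# _) (x-z+z≈x b 1#)) (+-monoˡ-< (b - 1#) 0<1) , []
  gapBelow b ((d , b′) ∷ xs) with gapBelow b xs
  ... | y , y<b , below with b′ ≤? y
  ...   | yes b′≤y = y , y<b , (λ _ → b′≤y) ∷ below
  ...   | no  b′≰y with b′ <.<? b
  ...     | yes b′<b = b′ , b′<b , (λ _ → inj₂ refl) ∷
    All.map (λ b″≤y b″<b → inj₁ (≤-<-trans (b″≤y b″<b) (≰⇒> b′≰y))) below
    where
    ≤-<-trans : ∀ {x y z} → x ≤ y → y < z → x < z
    ≤-<-trans (inj₁ x<y) y<z = <.trans x<y y<z
    ≤-<-trans (inj₂ x≈y) y<z = <-resp (sym x≈y) refl y<z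
  ...     | no  b′≮b = y , y<b , (λ b′<b → contradiction b′<b b′≮b) ∷ below

  StepsVanish : List Jump → Set _
  StepsVanish xs = ∀ y → ∑ xs (λ (d , b) → d * fromℚ (step b y)) ≈ 0#

  -- Between the `y` of `gapBelow` and `b`, only the steps located exactly at `b` change value, each
  -- from 0 to 1. The difference of the two vanishing sums is therefore the total coefficient at
  -- `b`.
  jump-vanishes : ∀ xs → StepsVanish xs → ∀ b → ∑ xs (jumpAt b) ≈ 0#
  jump-vanishes xs vanish b with gapBelow b xs
  ... | y , y<b , below = begin
    ∑ xs (jumpAt b)                                              ≈⟨ +-identityˡ _ ⟨
    0# + ∑ xs (jumpAt b)                                         ≈⟨ +-congʳ (vanish y) ⟨
    ∑ xs (λ (d , b′) → d * fromℚ (step b′ y)) + ∑ xs (jumpAt b)  ≈⟨ ∑-+ xs _ _ ⟨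
    ∑ xs (λ (d , b′) → d * fromℚ (step b′ y) + jumpAt b (d , b′))
      ≈⟨ ∑-congᴬ (All.map (λ {(d , b′)} → jump d b′) below) ⟨
    ∑ xs (λ (d , b′) → d * fromℚ (step b′ b))                    ≈⟨ vanish b ⟩
    0#                                                           ∎
    where
    value-of : ∀ {d q q′} → q ≡ q′ → d * fromℚ q ≈ d * fromℚ q′
    value-of eq = *-congˡ (reflexive (≡.cong fromℚ eq))

    jump : ∀ d b′ → (b′ < b → b′ ≤ y) →
           d * fromℚ (step b′ b) ≈ d * fromℚ (step b′ y) + jumpAt b (d , b′)
    jump d b′ b′≤y = split (<.compare b′ b)
      where
      split : Tri (b′ < b) (b′ ≈ b) (b < b′) →
              d * fromℚ (step b′ b) ≈ d * fromℚ (step b′ y) + jumpAt b (d , b′)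
      split (tri< b′<b b′≉b _) = begin
        d * fromℚ (step b′ b)
          ≈⟨ value-of (≡.trans (step-≤ (inj₁ b′<b)) (≡.sym (step-≤ (b′≤y b′<b)))) ⟩
        d * fromℚ (step b′ y)                      ≈⟨ +-identityʳ _ ⟨
        d * fromℚ (step b′ y) + 0#                 ≈⟨ +-congˡ (reflexive (jumpAt-≉ d b′≉b)) ⟨
        d * fromℚ (step b′ y) + jumpAt b (d , b′)  ∎
      split (tri≈ _ b′≈b _) = begin
        d * fromℚ (step b′ b)                      ≈⟨ value-of (step-≤ (inj₂ b′≈b)) ⟩
        d * fromℚ 1ℚ                               ≈⟨ trans (*-congˡ fromℚ-1) (*-identityʳ d) ⟩
        d                                          ≈⟨ +-identityˡ d ⟨
        0# + d                                     ≈⟨ +-congʳ (trans (*-congˡ fromℚ-0) (zeroʳ d)) ⟨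
        d * fromℚ 0ℚ + d
          ≈⟨ +-congʳ (value-of (step-> (<-resp refl (sym b′≈b) y<b))) ⟨
        d * fromℚ (step b′ y) + d                  ≈⟨ +-congˡ (reflexive (jumpAt-≈ d b′≈b)) ⟨
        d * fromℚ (step b′ y) + jumpAt b (d , b′)  ∎
      split (tri> _ b′≉b b<b′) = begin
        d * fromℚ (step b′ b)
          ≈⟨ value-of (≡.trans (step-> b<b′) (≡.sym (step-> (<.trans y<b b<b′)))) ⟩
        d * fromℚ (step b′ y)                      ≈⟨ +-identityʳ _ ⟨
        d * fromℚ (step b′ y) + 0#                 ≈⟨ +-congˡ (reflexive (jumpAt-≉ d b′≉b)) ⟨
        d * fromℚ (step b′ y) + jumpAt b (d , b′)  ∎

  away-vanishes : ∀ b xs → StepsVanish xs → StepsVanish (away b xs)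
  away-vanishes b xs vanish y = begin
    ∑ (away b xs) f
      ≈⟨ +-identityˡ _ ⟨
    0# + ∑ (away b xs) f
      ≈⟨ +-congʳ (trans (*-congʳ (jump-vanishes xs vanish b)) (zeroˡ _)) ⟨
    ∑ xs (jumpAt b) * fromℚ (step b y) + ∑ (away b xs) f
      ≈⟨ ∑-away b xs (λ b′ → fromℚ (step b′ y)) (λ b≈ → reflexive (≡.cong fromℚ (step-cong b≈))) ⟨
    ∑ xs f
      ≈⟨ vanish y ⟩
    0#
      ∎
    where
    f : Jump → Carrier
    f (d , b′) = d * fromℚ (step b′ y)

  firstMoment-vanishes : ∀ n xs → List.length xs ℕ.≤ n → StepsVanish xs → ∑ xs (λ (d , b) → d * b) ≈ 0#
  firstMoment-vanishes n       []                _    vanish = refl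
  firstMoment-vanishes (suc n) xs@((d , b) ∷ _) len≤ vanish = begin
    ∑ xs (λ (d , b) → d * b)
      ≈⟨ ∑-away b xs id id ⟩
    ∑ xs (jumpAt b) * b + ∑ (away b xs) (λ (d , b) → d * b)
      ≈⟨ +-cong (trans (*-congʳ (jump-vanishes xs vanish b)) (zeroˡ b))
                (firstMoment-vanishes n (away b xs) shorter (away-vanishes b xs vanish)) ⟩
    0# + 0#
      ≈⟨ +-identityˡ 0# ⟩
    0#
      ∎
    where
    shorter : List.length (away b xs) ℕ.≤ n
    shorter = ℕ.s≤s⁻¹ (ℕ.≤-trans
      (List.filter-notAll (λ (_ , b′) → ¬? (b′ <.≟ b)) xs (here λ b≉b → b≉b refl)) len≤)

  lengths-vanish : ∀ {a} {A : Set a} (xs : List A) (w : A → Carrier) (I : A → Interval) →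
    (∀ x → ∑ xs (λ i → w i * fromℚ (indicatorᴵ (I i) x)) ≈ 0#) →
    ∑ xs (λ i → w i * Interval.length (I i)) ≈ 0#
  lengths-vanish {A = A} xs w I vanish = begin
    ∑ xs (λ i → w i * Interval.length (I i))
      ≈⟨ ∑-cong xs (λ i →
           solve 3 (λ w l h → w :* (h :- l) := (:- w) :* l :+ (w :* h :+ con ℤ.0ℤ)) refl (w i) _ _) ⟩
    ∑ xs (λ i → ∑ (jumps i) (λ (d , b) → d * b))
      ≈⟨ ∑-concatMap jumps xs _ ⟨
    ∑ (concatMap jumps xs) (λ (d , b) → d * b)
      ≈⟨ firstMoment-vanishes _ (concatMap jumps xs) ℕ.≤-refl steps-vanish ⟩
    0#
      ∎
    where
    open Solver

    jumps : A → List Jump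
    -- The signs are opposite to those of `indicatorᴵ`: the first moment is then the length itself,
    -- and the combination of steps is minus the indicator.
    jumps i = (- w i , Interval.lo (I i)) ∷ (w i , Interval.hi (I i)) ∷ []

    steps-vanish : StepsVanish (concatMap jumps xs)
    steps-vanish x = begin
      ∑ (concatMap jumps xs) (λ (d , b) → d * fromℚ (step b x))
        ≈⟨ ∑-concatMap jumps xs _ ⟩
      ∑ xs (λ i → ∑ (jumps i) (λ (d , b) → d * fromℚ (step b x)))
        ≈⟨ ∑-cong xs (λ i → begin
             ∑ (jumps i) (λ (d , b) → d * fromℚ (step b x))
               ≈⟨ solve 3 (λ w l h → (:- w) :* l :+ (w :* h :+ con ℤ.0ℤ) := :- (w :* (l :- h)))
                    refl (w i) _ _ ⟩
             - (w i * (fromℚ (step (Interval.lo (I i)) x) - fromℚ (step (Interval.hi (I i)) x)))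
               ≈⟨ -‿cong (*-congˡ (fromℚ-- (step (Interval.lo (I i)) x) (step (Interval.hi (I i)) x))) ⟨
             - (w i * fromℚ (indicatorᴵ (I i) x))
               ∎) ⟩
      ∑ xs (λ i → - (w i * fromℚ (indicatorᴵ (I i) x)))
        ≈⟨ ∑-neg xs _ ⟩
      - ∑ xs (λ i → w i * fromℚ (indicatorᴵ (I i) x))
        ≈⟨ -‿cong (vanish x) ⟩
      - 0#
        ≈⟨ -0#≈0# ⟩
      0#
        ∎

  -- A discrete Fubini argument. For fixed `y`, `lengths-vanish` in the horizontal direction, with
  -- the vertical indicators at `y` as part of the weights, replaces horizontal indicators by
  -- widths. The resulting relation holds for every `y`, so a second application replaces the
  -- vertical indicators by heights.
  areas-vanish : (Ps : List Piece) → (∀ p → ℚ-Sum.∑ Ps (pieceValue p) ≡ 0ℚ) →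
                 ∑ Ps (λ (a , R) → fromℚ a * Rectangle.area R) ≈ 0#
  areas-vanish Ps vanish = begin
    ∑ Ps (λ (a , R) → fromℚ a * Rectangle.area R)
      ≈⟨ ∑-cong Ps (λ (a , R) → sym (*-assoc _ _ _)) ⟩
    ∑ Ps (λ (a , R) → fromℚ a * Rectangle.width R * Rectangle.height R)
      ≈⟨ lengths-vanish Ps (λ (a , R) → fromℚ a * Rectangle.width R) (Rectangle.vertical ∘ proj₂) (λ y → begin
           ∑ Ps (λ (a , R) → fromℚ a * Rectangle.width R * vᵢ R y)
             ≈⟨ ∑-cong Ps (λ (a , R) → xy∙z≈xz∙y _ _ _) ⟩
           ∑ Ps (λ (a , R) → fromℚ a * vᵢ R y * Rectangle.width R)
             ≈⟨ lengths-vanish Ps (λ (a , R) → fromℚ a * vᵢ R y) (Rectangle.horizontal ∘ proj₂) (λ x → begin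
                  ∑ Ps (λ (a , R) → fromℚ a * vᵢ R y * hᵢ R x)
                    ≈⟨ ∑-cong Ps (λ (a , R) → trans (xy∙z≈x∙zy _ _ _) (sym (pieceValue-split a R x y))) ⟩
                  ∑ Ps (fromℚ ∘ pieceValue (x , y))
                    ≈⟨ fromℚ-∑ Ps (pieceValue (x , y)) ⟨
                  fromℚ (ℚ-Sum.∑ Ps (pieceValue (x , y)))
                    ≡⟨ ≡.cong fromℚ (vanish (x , y)) ⟩
                  fromℚ 0ℚ
                    ≈⟨ fromℚ-0 ⟩
                  0#
                    ∎) ⟩
           0# ∎) ⟩
    0#
      ∎
    where
    open CommutativeSemigroupₚ *-commutativeSemigroup using (xy∙z≈xz∙y; xy∙z≈x∙zy)

    hᵢ vᵢ : Rectangle → Carrier → Carrier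
    hᵢ R x = fromℚ (indicatorᴵ (Rectangle.horizontal R) x)
    vᵢ R y = fromℚ (indicatorᴵ (Rectangle.vertical R) y)

    pieceValue-split : ∀ a R x y → fromℚ (a ℚ.* indicator R (x , y)) ≈ fromℚ a * (hᵢ R x * vᵢ R y)
    pieceValue-split a R x y = trans (fromℚ-* a (indicator R (x , y))) (*-congˡ
      (fromℚ-* (indicatorᴵ (Rectangle.horizontal R) x) (indicatorᴵ (Rectangle.vertical R) y)))

  area-place : ∀ ρ v R → Rectangle.area (place ρ v R) ≈ (proj₁ ρ * proj₁ ρ) * Rectangle.area R
  area-place (ρ , _) (u , v) R =
    solve 7 (λ ρ u v b₁ b₂ c₁ c₂ →
      ((ρ :* b₂ :+ u) :- (ρ :* b₁ :+ u)) :* ((ρ :* c₂ :+ v) :- (ρ :* c₁ :+ v)) :=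
      (ρ :* ρ) :* ((b₂ :- b₁) :* (c₂ :- c₁))) refl ρ u v b₁ b₂ c₁ c₂
    where
    open Solver
    open Rectangle R

  area>0 : ∀ R → 0# < Rectangle.area R
  area>0 R = *-pos (x-y>0 (Interval.lo<hi horizontal)) (x-y>0 (Interval.lo<hi vertical))
    where open Rectangle R

  shapetiles⇒area≉0 : ∀ T S → ℚ-Shapetiles T (rectangleTile S) → ¬ weightedArea T ≈ 0#
  shapetiles⇒area≉0 T S (placed , tiles) area≈0 = 0<x⇒x≉0 (area>0 S) (begin
    Rectangle.area S
      ≈⟨ +-identityʳ _ ⟨
    Rectangle.area S + 0#
      ≈⟨ +-congˡ (areas-vanish Ps vanish) ⟨
    Rectangle.area S + (fromℚ (ℚ.- 1ℚ) * Rectangle.area S + ∑ (concatMap (copy T) placed) areaOf)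
      ≈⟨ +-congˡ (+-cong (*-congʳ (trans (fromℚ-neg 1ℚ) (-‿cong fromℚ-1))) placed-area) ⟩
    Rectangle.area S + (- 1# * Rectangle.area S + 0#)
      ≈⟨ +-congˡ (trans (+-identityʳ _) (trans (sym (-‿distribˡ-* 1# _)) (-‿cong (*-identityˡ _)))) ⟩
    Rectangle.area S - Rectangle.area S
      ≈⟨ -‿inverseʳ _ ⟩
    0#
      ∎)
    where
    areaOf : Piece → Carrier
    areaOf (a , R) = fromℚ a * Rectangle.area R

    Ps : List Piece
    -- Weight -1 on `S` turns the tiling into a combination that vanishes at every point. Each copy
    -- then contributes a multiple of the area of `T`, so if that area were zero, only the area of
    -- `S` would be left.
    Ps = (ℚ.- 1ℚ , S) ∷ concatMap (copy T) placed

    vanish : ∀ p → ℚ-Sum.∑ Ps (pieceValue p) ≡ 0ℚ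
    vanish p = ≡.trans
      (≡.cong (ℚ.- 1ℚ ℚ.* indicator S p ℚ.+_) (≡.trans (ℚ-Sum.∑-concatMap (copy T) placed (pieceValue p))
        (≡.trans (ℚ-Sum.∑-cong placed λ (a , ρ , v) → value-copy T a ρ v p)
          (≡.trans (≡.sym (combination-∑ T placed p))
            (≡.trans (tiles p) (value-rectangleTile S p))))))
      (solve 1 (λ x → con (ℚ.- 1ℚ) :* x :+ x := con 0ℚ) ≡.refl (indicator S p))
      where open ℚ-Solver.+-*-Solver

    copy-area : ∀ a ρ v → ∑ (copy T (a , ρ , v)) areaOf ≈ 0#
    copy-area a ρ v = begin
      ∑ (copy T (a , ρ , v)) areaOf
        ≈⟨ ∑-map _ (Tile.pieces T) areaOf ⟩
      ∑ (Tile.pieces T) (λ (c , R) → fromℚ (a ℚ.* c) * Rectangle.area (place ρ v R))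
        ≈⟨ ∑-cong (Tile.pieces T) (λ (c , R) → trans (*-cong (fromℚ-* a c) (area-place ρ v R))
             (solve 4 (λ a c r s → (a :* c) :* (r :* s) := (a :* r) :* (c :* s)) refl _ _ _ _)) ⟩
      ∑ (Tile.pieces T) (λ (c , R) → (fromℚ a * (proj₁ ρ * proj₁ ρ)) * (fromℚ c * Rectangle.area R))
        ≈⟨ ∑-distribˡ _ (Tile.pieces T) areaOf ⟨
      (fromℚ a * (proj₁ ρ * proj₁ ρ)) * weightedArea T
        ≈⟨ *-congˡ area≈0 ⟩
      (fromℚ a * (proj₁ ρ * proj₁ ρ)) * 0#
        ≈⟨ zeroʳ _ ⟩
      0#
        ∎
      where open Solver

    placed-area : ∑ (concatMap (copy T) placed) areaOf ≈ 0#
    placed-area = trans (∑-concatMap (copy T) placed areaOf)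
      (trans (∑-cong placed λ (a , ρ , v) → copy-area a ρ v) (∑-zero placed))

-- Packs each piece with its measured sides, so that `cells` can read off how many cells to produce.
All-attach : ∀ {a p} {A : Set a} {P : A → Set p} {xs} → All P xs →
             ∃ λ (ys : List (Σ A P)) → map proj₁ ys ≡ xs
All-attach []         = [] , ≡.refl
All-attach (px ∷ pxs) with All-attach pxs
... | ys , ≡.refl = (_ , px) ∷ ys , ≡.refl

-- A common measure of all the sides.

module CommonGrid {c ℓ₁ ℓ₂} (ℝ : RealNumbers c ℓ₁ ℓ₂) where

  open Tiling ℝ
  open RealArithmetic ℝ
  open SemiringMult semiring using (×-assocˡ; ×-assoc-*; ×-congʳ) renaming (_×_ to _·_)
  open ≈-Reasoning setoid

  ·≈* : ∀ n x → n · x ≈ (n · 1#) * x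
  ·≈* n x = sym (trans (×-assoc-* n 1# x) (×-congʳ n (*-identityˡ x)))

  ·-pos : ∀ n .{{_ : NonZero n}} {x} → 0# < x → 0# < n · x
  ·-pos (suc n) 0<x = <-resp refl (sym (·≈* (suc n) _)) (*-pos (0<[1+n]·1 n) 0<x)

  Integral : ℕ → Carrier → Set _
  Integral D x = ∃ λ k → D · x ≈ k · 1#

  Integral-∣ : ∀ {D E} x → D ∣ E → Integral D x → Integral E x
  Integral-∣ {D} x (divides q ≡.refl) (k , Dx≈k) = q ℕ.* k , (begin
    (q ℕ.* D) · x   ≈⟨ ×-assocˡ x q D ⟨
    q · (D · x)     ≈⟨ ×-congʳ q Dx≈k ⟩
    q · (k · 1#)    ≈⟨ ×-assocˡ 1# q k ⟩
    (q ℕ.* k) · 1#  ∎)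

  -- The lengths are what gets measured, because each rectangle is later cut into cells starting
  -- from its own corner.
  Integral-length : ∀ I → IsRational (Interval.lo I) → IsRational (Interval.hi I) →
                    ∃ λ D → NonZero D × Integral D (Interval.length I)
  Integral-length I (q , lo≈q) (r , hi≈r) = D , _ , proj₁ numerator , (begin
    D · length               ≈⟨ ·≈* D length ⟩
    (D · 1#) * length        ≈⟨ *-comm _ _ ⟩
    length * (D · 1#)        ≈⟨ *-congʳ length≈ ⟩
    fromℚ s * fromℤ (↧ s)    ≈⟨ proj₂ numerator ⟩
    proj₁ numerator · 1#     ∎)
    where
    open Interval I

    s : ℚ
    s = r ℚ.- q

    D : ℕ
    D = ℚ.denominatorℕ s

    length≈ : length ≈ fromℚ s
    length≈ = trans (+-cong hi≈r (-‿cong lo≈q)) (sym (fromℚ-- r q))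

    numerator : ∃ λ n → fromℚ s * fromℤ (↧ s) ≈ n · 1#
    numerator = positive-rational s (<-resp refl length≈ (x-y>0 lo<hi))

  commonDenominator : ∀ {Ps : List Piece} → All (λ P → HasRationalCorners (proj₂ P)) Ps →
    ∃ λ D → NonZero D ×
            All (λ (_ , R) → Integral D (Rectangle.width R) × Integral D (Rectangle.height R)) Ps
  commonDenominator []                                         = 1 , _ , []
  commonDenominator {(_ , R) ∷ _} (((b₁ , b₂) , (c₁ , c₂)) ∷ rational)
    with Integral-length (Rectangle.horizontal R) b₁ b₂
       | Integral-length (Rectangle.vertical R) c₁ c₂
       | commonDenominator rational
  ... | D₁ , D₁≢0 , w | D₂ , D₂≢0 , h | D , D≢0 , rest =
    D₁ ℕ.* (D₂ ℕ.* D) , ℕ.m*n≢0 D₁ (D₂ ℕ.* D) {{D₁≢0}} {{ℕ.m*n≢0 D₂ D {{D₂≢0}} {{D≢0}}}} ,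
    (Integral-∣ width D₁∣ w , Integral-∣ height D₂∣ h) ∷
    All.map (λ (w , h) → Integral-∣ _ D∣ w , Integral-∣ _ D∣ h) rest
    where
    open Rectangle R using (width; height)

    D₁∣ : D₁ ∣ D₁ ℕ.* (D₂ ℕ.* D)
    D₁∣ = m∣m*n (D₂ ℕ.* D)

    D₂∣ : D₂ ∣ D₁ ℕ.* (D₂ ℕ.* D)
    D₂∣ = ∣-trans (m∣m*n D) (n∣m*n D₁)

    D∣ : D ∣ D₁ ℕ.* (D₂ ℕ.* D)
    D∣ = ∣-trans (n∣m*n D₂) (n∣m*n D₁)

  Measured : Carrier → Rectangle → Set _
  Measured δ R = (∃ λ k → Rectangle.width R ≈ k · δ) × (∃ λ l → Rectangle.height R ≈ l · δ)

  commonMeasure : ∀ {Ps : List Piece} → All (λ P → HasRationalCorners (proj₂ P)) Ps →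
                  ∃ λ δ → 0# < δ × All (λ P → Measured δ (proj₂ P)) Ps
  commonMeasure rational with commonDenominator rational
  ... | D , D≢0 , integral = D# ⁻¹ , 0<⁻¹ 0<D , All.map (λ (w , h) → measure w , measure h) integral
    where
    D# : Carrier
    D# = D · 1#

    0<D : 0# < D#
    0<D = ·-pos D {{D≢0}} 0<1

    measure : ∀ {x} → Integral D x → ∃ λ k → x ≈ k · (D# ⁻¹)
    measure {x} (k , Dx≈k) = k , (begin
      x                      ≈⟨ ρρ⁻¹x≈x 0<D x ⟨
      D# * (D# ⁻¹ * x)       ≈⟨ solve 3 (λ d e x → d :* (e :* x) := (d :* x) :* e) refl D# (D# ⁻¹) x ⟩
      (D# * x) * D# ⁻¹       ≈⟨ *-congʳ (trans (sym (·≈* D x)) Dx≈k) ⟩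
      (k · 1#) * D# ⁻¹       ≈⟨ ·≈* k (D# ⁻¹) ⟨
      k · (D# ⁻¹)              ∎)
      where open Solver

-- Construction of a square and of its tiling.

module SquareTiling {c ℓ₁ ℓ₂} (ℝ : RealNumbers c ℓ₁ ℓ₂) where

  open Tiling ℝ
  open RealArithmetic ℝ
  open Indicators ℝ
  open CommonGrid ℝ
  open SemiringMult semiring using (×-assocˡ; ×-congʳ; ×-homo-+) renaming (_×_ to _·_)

  plane : AbelianGroup _ _
  plane = DirectProduct.abelianGroup +-abelianGroup +-abelianGroup

  open AbelianGroup plane using () renaming (_∙_ to _⊹_; ε to origin; _≈_ to _≈ᴾ_)
  open MonoidMult (AbelianGroup.monoid plane) using () renaming (_×_ to _·ᴾ_)
  open Elimination plane

  ·ᴾ-proj : ∀ m v → m ·ᴾ v ≡ (m · proj₁ v , m · proj₂ v)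
  ·ᴾ-proj zero    v = ≡.refl
  ·ᴾ-proj (suc m) v = ≡.cong (v ⊹_) (·ᴾ-proj m v)

  -- Offset by one in agreement with `eliminant`, so that every index occurring there is a positive
  -- scale.
  naturalScale : ℕ → PositiveReal
  naturalScale m = suc m · 1# , 0<[1+n]·1 m

  interval : ∀ {L} → 0# < L → Carrier → Interval
  interval {L} 0<L a = record
    { lo    = a
    ; hi    = a + L
    ; lo<hi = <-resp (+-identityˡ a) (+-comm L a) (+-monoˡ-< a 0<L)
    }

  square : ∀ {L} → 0# < L → Point → Rectangle
  square 0<L (a , b) = record { horizontal = interval 0<L a ; vertical = interval 0<L b }

  indicator-square-cong : ∀ {L} (0<L : 0# < L) p {u v} → u ≈ᴾ v →
                          indicator (square 0<L u) p ≡ indicator (square 0<L v) p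
  indicator-square-cong 0<L p (a≈ , b≈) = ≡.cong₂ ℚ._*_
    (≡.cong₂ ℚ._-_ (step-cong a≈) (step-cong (+-congʳ a≈)))
    (≡.cong₂ ℚ._-_ (step-cong b≈) (step-cong (+-congʳ b≈)))

  module _ (δ : Carrier) where

    GridPiece : Set _
    GridPiece = Σ Piece (Measured δ ∘ proj₂)

    -- The pairs of weight `cⱼ` and corner `vⱼ` of the overview. Their second components become the
    -- ratios of the geometric sequences.
    cells : GridPiece → List (ℚ × Point)
    cells ((a , R) , (k , _) , (l , _)) =
      cartesianProductWith (λ i j → a , (Rectangle.b₁ R + i · δ , Rectangle.c₁ R + j · δ))
        (downFrom k) (downFrom l)

    module _ where
      open ≈-Reasoning setoid
      open ListSum commutativeRing

      cells-area : ∀ G → fromℚ (ℚ-Sum.∑ (cells G) proj₁) * (δ * δ) ≈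
                   fromℚ (proj₁ (proj₁ G)) * Rectangle.area (proj₂ (proj₁ G))
      cells-area G@((a , R) , (k , w≈) , (l , h≈)) = begin
        fromℚ (ℚ-Sum.∑ (cells G) proj₁) * (δ * δ)
          ≈⟨ *-congʳ (fromℚ-∑ (cells G) proj₁) ⟩
        ∑ (cells G) (fromℚ ∘ proj₁) * (δ * δ)
          ≈⟨ *-congʳ (∑-cartesianProductWith _ (downFrom k) (downFrom l) _) ⟩
        ∑ (downFrom k) (λ _ → ∑ (downFrom l) (λ _ → fromℚ a)) * (δ * δ)
          ≈⟨ *-congʳ (trans (∑-const k _) (×-congʳ k (∑-const l (fromℚ a)))) ⟩
        (k · (l · fromℚ a)) * (δ * δ)
          ≈⟨ *-congʳ (trans (·≈* k _) (*-congˡ (·≈* l (fromℚ a)))) ⟩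
        ((k · 1#) * ((l · 1#) * fromℚ a)) * (δ * δ)
          ≈⟨ solve 4 (λ k l a δ → (k :* (l :* a)) :* (δ :* δ) := a :* ((k :* δ) :* (l :* δ)))
               refl _ _ _ _ ⟩
        fromℚ a * (((k · 1#) * δ) * ((l · 1#) * δ))
          ≈⟨ *-congˡ (*-cong (trans w≈ (·≈* k δ)) (trans h≈ (·≈* l δ))) ⟨
        fromℚ a * Rectangle.area R
          ∎
        where open Solver

      gridArea : ∀ Gs → fromℚ (ℚ-Sum.∑ (concatMap cells Gs) proj₁) * (δ * δ) ≈
                 ∑ (map proj₁ Gs) (λ (a , R) → fromℚ a * Rectangle.area R)
      gridArea Gs = begin
        fromℚ (ℚ-Sum.∑ (concatMap cells Gs) proj₁) * (δ * δ)
          ≡⟨ ≡.cong (λ q → fromℚ q * (δ * δ)) (ℚ-Sum.∑-concatMap cells Gs proj₁) ⟩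
        fromℚ (ℚ-Sum.∑ Gs (λ G → ℚ-Sum.∑ (cells G) proj₁)) * (δ * δ)
          ≈⟨ *-congʳ (fromℚ-∑ Gs (λ G → ℚ-Sum.∑ (cells G) proj₁)) ⟩
        ∑ Gs (λ G → fromℚ (ℚ-Sum.∑ (cells G) proj₁)) * (δ * δ)
          ≈⟨ ∑-distribʳ (δ * δ) Gs _ ⟩
        ∑ Gs (λ G → fromℚ (ℚ-Sum.∑ (cells G) proj₁) * (δ * δ))
          ≈⟨ ∑-cong Gs cells-area ⟩
        ∑ Gs (λ G → fromℚ (proj₁ (proj₁ G)) * Rectangle.area (proj₂ (proj₁ G)))
          ≈⟨ ∑-map proj₁ Gs _ ⟨
        ∑ (map proj₁ Gs) (λ (a , R) → fromℚ a * Rectangle.area R)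
          ∎

    open ≡.≡-Reasoning
    open ℚ-Sum

    -- With ε = (suc m) δ, both sides are (1 - t ᵏ)(1 - t ᴷ) / (1 - t) applied to a step, where
    -- t is translation by ε.
    ∑-translatesᴵ : ∀ I k → Interval.length I ≈ k · δ →
      ∀ m K {L} (0<L : 0# < L) → L ≈ (K ℕ.* suc m) · δ → ∀ u x →
      ∑ (downFrom K) (λ i →
        indicatorᴵ (translateᴵ (u + i · (suc m · δ)) (rescaleᴵ (naturalScale m) I)) x) ≡
      ∑ (downFrom k) (λ j → indicatorᴵ (interval 0<L (u + suc m · (Interval.lo I + j · δ))) x)
    ∑-translatesᴵ I k len≈ m K {L} 0<L L≈ u x = begin
      ∑ (downFrom K) (λ i → indicatorᴵ (translateᴵ (u + i · ε) (rescaleᴵ (naturalScale m) I)) x)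
        ≡⟨ ∑-cong (downFrom K) (λ i → ≡.cong₂ ℚ._-_ (step-cong (left-lo i)) (step-cong (left-hi i))) ⟩
      ∑ (downFrom K) (λ i → h i ℚ.- h (i ℕ.+ k))
        ≡⟨ ∑-differences K k h ⟩
      ∑ (downFrom k) (λ j → h j ℚ.- h (j ℕ.+ K))
        ≡⟨ ∑-cong (downFrom k) (λ j → ≡.cong₂ ℚ._-_ (step-cong (right-lo j)) (step-cong (right-hi j))) ⟩
      ∑ (downFrom k) (λ j → indicatorᴵ (interval 0<L (u + suc m · (lo + j · δ))) x)
        ∎
      where
      open Interval I
      open Solver
      module ≈R = ≈-Reasoning setoid

      ρ ε : Carrier
      ρ = suc m · 1#
      ε = suc m · δ

      h : ℕ → ℚ
      h i = step (ρ * lo + u + i · ε) x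

      left-lo : ∀ i → ρ * lo + (u + i · ε) ≈ ρ * lo + u + i · ε
      left-lo i = sym (+-assoc _ _ _)

      hi≈ : hi ≈ lo + (k · 1#) * δ
      hi≈ = trans (sym (x-z+z≈x hi lo)) (trans (+-comm _ _) (+-congˡ (trans len≈ (·≈* k δ))))

      ·ε : ∀ i → i · ε ≈ (i · 1#) * (ρ * δ)
      ·ε i = trans (·≈* i ε) (*-congˡ (·≈* (suc m) δ))

      left-hi : ∀ i → ρ * hi + (u + i · ε) ≈ ρ * lo + u + (i ℕ.+ k) · ε
      left-hi i = ≈R.begin
        ρ * hi + (u + i · ε)
          ≈R.≈⟨ +-cong (*-congˡ hi≈) (+-congˡ (·ε i)) ⟩
        ρ * (lo + (k · 1#) * δ) + (u + (i · 1#) * (ρ * δ))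
          ≈R.≈⟨ solve 6 (λ ρ l k δ u i → ρ :* (l :+ k :* δ) :+ (u :+ i :* (ρ :* δ)) :=
                   ρ :* l :+ u :+ (i :* (ρ :* δ) :+ k :* (ρ :* δ))) refl ρ lo (k · 1#) δ u (i · 1#) ⟩
        ρ * lo + u + ((i · 1#) * (ρ * δ) + (k · 1#) * (ρ * δ))
          ≈R.≈⟨ +-congˡ (trans (×-homo-+ ε i k) (+-cong (·ε i) (·ε k))) ⟨
        ρ * lo + u + (i ℕ.+ k) · ε
          ≈R.∎

      right-lo : ∀ j → ρ * lo + u + j · ε ≈ u + suc m · (lo + j · δ)
      right-lo j = ≈R.begin
        ρ * lo + u + j · ε
          ≈R.≈⟨ +-congˡ (·ε j) ⟩
        ρ * lo + u + (j · 1#) * (ρ * δ)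
          ≈R.≈⟨ solve 5 (λ ρ l u j δ → ρ :* l :+ u :+ j :* (ρ :* δ) := u :+ ρ :* (l :+ j :* δ))
                  refl ρ lo u (j · 1#) δ ⟩
        u + ρ * (lo + (j · 1#) * δ)
          ≈R.≈⟨ +-congˡ (trans (·≈* (suc m) _) (*-congˡ (+-congˡ (·≈* j δ)))) ⟨
        u + suc m · (lo + j · δ)
          ≈R.∎

      right-hi : ∀ j → ρ * lo + u + (j ℕ.+ K) · ε ≈ u + suc m · (lo + j · δ) + L
      right-hi j = ≈R.begin
        ρ * lo + u + (j ℕ.+ K) · ε         ≈R.≈⟨ +-congˡ (×-homo-+ ε j K) ⟩
        ρ * lo + u + (j · ε + K · ε)       ≈R.≈⟨ +-assoc _ _ _ ⟨
        ρ * lo + u + j · ε + K · ε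
          ≈R.≈⟨ +-cong (right-lo j) (trans (×-assocˡ δ K (suc m)) (sym L≈)) ⟩
        u + suc m · (lo + j · δ) + L       ≈R.∎

    -- A cell at `w` rescaled by `suc m` has side `suc m · δ` and corner `suc m ·ᴾ w`; its `K` by
    -- `K` translates fill a square of side `L` at that corner, shifted by `(u , v)`. For a whole
    -- rectangle the double sum factors into a horizontal and a vertical sum, and `∑-translatesᴵ`
    -- applies to each.
    ∑-translates : ∀ T Gs → map proj₁ Gs ≡ Tile.pieces T →
      ∀ m K {L} (0<L : 0# < L) → L ≈ (K ℕ.* suc m) · δ →
      ∀ ((u , v) : Point) p →
      ∑ (downFrom K) (λ i → ∑ (downFrom K) (λ j →
        value (translate (u + i · (suc m · δ) , v + j · (suc m · δ)) (rescale (naturalScale m) T)) p)) ≡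
      dilate (concatMap cells Gs) (λ w → indicator (square 0<L w) p) (suc m) (u , v)
    ∑-translates T Gs Gs≡ m K 0<L L≈ (u , v) p@(x , y) = begin
      ∑ (downFrom K) (λ i → ∑ (downFrom K) (λ j → value (translate (shift i j) (rescale ρ T)) p))
        ≡⟨ ∑-cong (downFrom K) (λ i → ≡.trans
             (∑-cong (downFrom K) λ j → ≡.trans (value-place T ρ (shift i j) p)
               (≡.trans (≡.cong (λ Ps → ∑ Ps (placed i j)) (≡.sym Gs≡)) (∑-map proj₁ Gs (placed i j))))
             (∑-swap (downFrom K) Gs (λ j G → placed i j (proj₁ G)))) ⟩
      ∑ (downFrom K) (λ i → ∑ Gs (λ G → ∑ (downFrom K) (λ j → placed i j (proj₁ G))))
        ≡⟨ ∑-swap (downFrom K) Gs (λ i G → ∑ (downFrom K) (λ j → placed i j (proj₁ G))) ⟩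
      ∑ Gs (λ G → ∑ (downFrom K) (λ i → ∑ (downFrom K) (λ j → placed i j (proj₁ G))))
        ≡⟨ ∑-cong Gs regroup ⟩
      ∑ Gs (λ G → ∑ (cells G) weighted)
        ≡⟨ ∑-concatMap cells Gs weighted ⟨
      dilate (concatMap cells Gs) φ (suc m) (u , v)
        ∎
      where
      ρ : PositiveReal
      ρ = naturalScale m

      shift : ℕ → ℕ → Point
      shift i j = u + i · (suc m · δ) , v + j · (suc m · δ)

      placed : ℕ → ℕ → Piece → ℚ
      placed i j (a , R) = a ℚ.* indicator (place ρ (shift i j) R) p

      φ : Point → ℚ
      φ w = indicator (square 0<L w) p

      weighted : ℚ × Point → ℚ
      weighted (a , w) = a ℚ.* φ ((u , v) ⊹ suc m ·ᴾ w)

      regroup : ∀ G → ∑ (downFrom K) (λ i → ∑ (downFrom K) (λ j → placed i j (proj₁ G))) ≡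
                      ∑ (cells G) weighted
      regroup G@((a , R) , (k , w≈) , (l , h≈)) = begin
        ∑ (downFrom K) (λ i → ∑ (downFrom K) (λ j → a ℚ.* (H i ℚ.* V j)))
          ≡⟨ ∑-∑-* a (downFrom K) (downFrom K) H V ⟩
        a ℚ.* (∑ (downFrom K) H ℚ.* ∑ (downFrom K) V)
          ≡⟨ ≡.cong (a ℚ.*_) (≡.cong₂ ℚ._*_
               (∑-translatesᴵ horizontal k w≈ m K 0<L L≈ u x)
               (∑-translatesᴵ vertical l h≈ m K 0<L L≈ v y)) ⟩
        a ℚ.* (∑ (downFrom k) H′ ℚ.* ∑ (downFrom l) V′)
          ≡⟨ ∑-∑-* a (downFrom k) (downFrom l) H′ V′ ⟨
        ∑ (downFrom k) (λ i → ∑ (downFrom l) (λ j → a ℚ.* (H′ i ℚ.* V′ j)))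
          ≡⟨ ∑-cong (downFrom k) (λ i → ∑-cong (downFrom l) λ j →
               ≡.cong (λ w → a ℚ.* φ ((u , v) ⊹ w)) (≡.sym (·ᴾ-proj (suc m) (b₁ + i · δ , c₁ + j · δ)))) ⟩
        ∑ (downFrom k) (λ i → ∑ (downFrom l) (λ j → weighted (a , (b₁ + i · δ , c₁ + j · δ))))
          ≡⟨ ∑-cartesianProductWith (λ i j → a , (b₁ + i · δ , c₁ + j · δ))
               (downFrom k) (downFrom l) weighted ⟨
        ∑ (cells G) weighted
          ∎
        where
        open Rectangle R
        H V H′ V′ : ℕ → ℚ
        H i = indicatorᴵ (translateᴵ (u + i · (suc m · δ)) (rescaleᴵ ρ horizontal)) x
        V j = indicatorᴵ (translateᴵ (v + j · (suc m · δ)) (rescaleᴵ ρ vertical)) y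
        H′ i = indicatorᴵ (interval 0<L (u + suc m · (b₁ + i · δ))) x
        V′ j = indicatorᴵ (interval 0<L (v + suc m · (c₁ + j · δ))) y

  area≉0⇒shapetiles : ∀ T → MadeOfRationalRectangles T → ¬ weightedArea T ≈ 0# →
                      ∃ λ S → IsSquare S × ℚ-Shapetiles T (rectangleTile S)
  area≉0⇒shapetiles T rational area≉0 with commonMeasure rational
  ... | δ , 0<δ , measured with All-attach measured
  ...   | Gs , Gs≡ = square 0<L origin , refl , concatMap copies E , tiles
      where
      open ℚ-Sum

      ws : List (ℚ × Point)
      ws = concatMap (cells δ) Gs

      W : ℚ
      W = ∑ ws proj₁

      W≢0 : ℚ.NonZero W
      W≢0 = ℚ.≢-nonZero {W} λ W≡0 → area≉0 (begin
        weightedArea T             ≡⟨ ≡.cong totalArea Gs≡ ⟨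
        totalArea (map proj₁ Gs)   ≈⟨ gridArea δ Gs ⟨
        fromℚ W * (δ * δ)          ≡⟨ ≡.cong (λ q → fromℚ q * (δ * δ)) W≡0 ⟩
        fromℚ 0ℚ * (δ * δ)         ≈⟨ *-congʳ fromℚ-0 ⟩
        0# * (δ * δ)               ≈⟨ zeroˡ _ ⟩
        0#                         ∎)
        where
        open ≈-Reasoning setoid

        totalArea : List Piece → Carrier
        totalArea Ps = ListSum.∑ commutativeRing Ps (λ (a , R) → fromℚ a * Rectangle.area R)

      W⁻¹ : ℚ
      W⁻¹ = ℚ.1/_ W {{W≢0}}

      E : List (ℚ × ℕ × Point)
      E = eliminant (map proj₂ ws)

      -- A common multiple of all the scales in `E`. Since `E` is computed from the corners of the
      -- cells alone, the side `L` can still be adapted to it.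
      n : ℕ
      n = product (map (λ (_ , m , _) → suc m) E)

      L : Carrier
      L = n · δ

      0<L : 0# < L
      0<L = ·-pos n {{product≢0 (Allₚ.map⁺ (All.universal (λ _ → _) E))}} 0<δ

      divisible : All (λ (_ , m , _) → suc m ∣ n) E
      divisible = All.tabulate λ e∈E → ∈⇒∣product (∈-map⁺ _ e∈E)

      copies : ℚ × ℕ × Point → List (ℚ × PositiveReal × Point)
      -- Each entry of `E` asks for a term of index `suc m`, which the translates with spacing
      -- `suc m · δ` build up. The factor `W⁻¹` cancels the total weight that `dilate-0` leaves in
      -- front of the square.
      copies (a , m , (u , v)) = cartesianProductWith
        (λ i j → W⁻¹ ℚ.* a , naturalScale m , (u + i · (suc m · δ) , v + j · (suc m · δ)))
        (downFrom (n ℕ./ suc m)) (downFrom (n ℕ./ suc m))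

      -- The point enters only now: the side and the list of copies are already fixed, as one tiling
      -- has to serve all points. Only `φ` and the values built on it vary with `p`.
      module _ (p : Point) where

        open ≡.≡-Reasoning

        φ : Point → ℚ
        φ w = indicator (square 0<L w) p

        geometric : GeometricSum (map proj₂ ws) (dilate ws φ)
        geometric = dilate-GeometricSum ws φ (indicator-square-cong 0<L p)

        copyValue : ℚ × PositiveReal × Point → ℚ
        copyValue (a , ρ , v) = a ℚ.* value (translate v (rescale ρ T)) p

        ∑-copies : ∀ a m w → suc m ∣ n →
                   ∑ (copies (a , m , w)) copyValue ≡ W⁻¹ ℚ.* (a ℚ.* dilate ws φ (suc m) (origin ⊹ w))
        ∑-copies a m w@(u , v) m∣n = begin
          ∑ (copies (a , m , w)) copyValue
            ≡⟨ ∑-cartesianProductWith _ (downFrom K) (downFrom K) copyValue ⟩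
          ∑ (downFrom K) (λ i → ∑ (downFrom K) (λ j → (W⁻¹ ℚ.* a) ℚ.* val i j))
            ≡⟨ ∑-cong (downFrom K) (λ i → ≡.sym (∑-distribˡ (W⁻¹ ℚ.* a) (downFrom K) (val i))) ⟩
          ∑ (downFrom K) (λ i → (W⁻¹ ℚ.* a) ℚ.* ∑ (downFrom K) (val i))
            ≡⟨ ≡.sym (∑-distribˡ (W⁻¹ ℚ.* a) (downFrom K) (λ i → ∑ (downFrom K) (val i))) ⟩
          (W⁻¹ ℚ.* a) ℚ.* ∑ (downFrom K) (λ i → ∑ (downFrom K) (val i))
            ≡⟨ ≡.cong ((W⁻¹ ℚ.* a) ℚ.*_) (∑-translates δ T Gs Gs≡ m K 0<L L≈ w p) ⟩
          (W⁻¹ ℚ.* a) ℚ.* dilate ws φ (suc m) w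
            ≡⟨ ℚ.*-assoc W⁻¹ a _ ⟩
          W⁻¹ ℚ.* (a ℚ.* dilate ws φ (suc m) w)
            ≡⟨ ≡.cong (λ q → W⁻¹ ℚ.* (a ℚ.* q))
                 (congruent geometric (suc m) (AbelianGroup.sym plane (AbelianGroup.identityˡ plane w))) ⟩
          W⁻¹ ℚ.* (a ℚ.* dilate ws φ (suc m) (origin ⊹ w))
            ∎
          where
          K : ℕ
          K = n ℕ./ suc m

          L≈ : L ≈ (K ℕ.* suc m) · δ
          L≈ = reflexive (≡.cong (_· δ) (≡.sym (m/n*n≡m m∣n)))

          val : ℕ → ℕ → ℚ
          val i j = value (translate (u + i · (suc m · δ) , v + j · (suc m · δ))
                                     (rescale (naturalScale m) T)) p

        tiles : combination (map (map₂ λ (ρ , v) → translate v (rescale ρ T)) (concatMap copies E)) p ≡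
                value (rectangleTile (square 0<L origin)) p
        tiles = begin
          combination (map (map₂ λ (ρ , v) → translate v (rescale ρ T)) (concatMap copies E)) p
            ≡⟨ combination-∑ T (concatMap copies E) p ⟩
          ∑ (concatMap copies E) copyValue
            ≡⟨ ∑-concatMap copies E copyValue ⟩
          ∑ E (λ e → ∑ (copies e) copyValue)
            ≡⟨ ∑-congᴬ (All.map (λ {(a , m , w)} → ∑-copies a m w) divisible) ⟩
          ∑ E (λ (a , m , w) → W⁻¹ ℚ.* (a ℚ.* dilate ws φ (suc m) (origin ⊹ w)))
            ≡⟨ ∑-distribˡ W⁻¹ E (λ (a , m , w) → a ℚ.* dilate ws φ (suc m) (origin ⊹ w)) ⟨
          W⁻¹ ℚ.* ∑ E (λ (a , m , w) → a ℚ.* dilate ws φ (suc m) (origin ⊹ w))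
            ≡⟨ ≡.cong (W⁻¹ ℚ.*_) (eliminate geometric origin) ⟨
          W⁻¹ ℚ.* dilate ws φ 0 origin
            ≡⟨ ≡.cong (W⁻¹ ℚ.*_) (dilate-0 ws φ (indicator-square-cong 0<L p) origin) ⟩
          W⁻¹ ℚ.* (W ℚ.* φ origin)
            ≡⟨ ℚ.*-assoc W⁻¹ W (φ origin) ⟨
          (W⁻¹ ℚ.* W) ℚ.* φ origin
            ≡⟨ ≡.cong (ℚ._* φ origin) (ℚ.*-inverseˡ W {{W≢0}}) ⟩
          1ℚ ℚ.* φ origin
            ≡⟨ ℚ.*-identityˡ (φ origin) ⟩
          φ origin
            ≡⟨ value-rectangleTile (square 0<L origin) p ⟨
          value (rectangleTile (square 0<L origin)) p
            ∎

theorem3p1 : ∀ {c ℓ₁ ℓ₂} (ℝ : RealNumbers c ℓ₁ ℓ₂) → let open Tiling ℝ in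
    (T : Tile) → MadeOfRationalRectangles T →
    (∃ λ S → IsSquare S × ℚ-Shapetiles T (rectangleTile S)) ⇔ (¬ weightedArea T ≈ 0#)
theorem3p1 ℝ T rational = mk⇔
  (λ (S , _ , tiles) → Area.shapetiles⇒area≉0 ℝ T S tiles)
  (SquareTiling.area≉0⇒shapetiles ℝ T rational)
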